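{- Let $S$ be a set of $n=|S|$ weighted activities, sorted by end time. The Type 1 activity selection algorithm (described in the context), which solves the weighted activity selection problem on $S$, takes $O(n\log n)$ work and $O(\mathrm{rank}(S)\log n)$ span.
   Context: Problem: activity $A_i$ has start time $s_i$, end time $e_i$ with $s_i<e_i$, and weight $w_i$. A set of activities is feasible if its members are pairwise non-overlapping ($A_i,A_j$ are non-overlapping if $e_j\le s_i$ or $e_i\le s_j$). The goal is to find a feasible set of maximum total weight. Define $dp[i]=w_i+\max\bigl(0,\max_{j:\,e_j\le s_i}dp[j]\bigr)$, the maximum weight of a feasible set that contains $A_i$ and is contained in $\{A_1,\dots,A_i\}$; the algorithm computes all $dp[i]$. $\mathrm{rank}(S)$ is the maximum number of pairwise non-overlapping activities in $S$. Type 1 algorithm: maintain two balanced augmented search trees, $T_{\mathrm{time}}$ holding the unprocessed activities keyed by start time and augmented with the minimum end time, and $T_{\mathrm{DP}}$ holding all activities keyed by end time and augmented with the maximum of the DP values computed so far. While $T_{\mathrm{time}}\neq\emptyset$: find the minimum end time $e^*$ among the unprocessed activities; split off from $T_{\mathrm{time}}$ the frontier of all unprocessed activities that overlap this earliest-end activity, i.e. those starting before $e^*$; for each activity $i$ in the frontier in parallel, compute $dp[i]$ by a range-maximum query on $T_{\mathrm{DP}}$ over end times at most $s_i$; then update these DP values in $T_{\mathrm{DP}}$ as a batch. Tree costs: on $n$ entries, the tree can be constructed from a sorted sequence, or flattened into one, in $O(n)$ work and $O(\log n)$ span; a split or a range query takes $O(\log n)$ work; a batch of $m\le n$ updates takes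 $O(m\log n)$ work and $O(\log n)$ span. Model: work-span binary-forking model. Threads share memory and run standard RAM instructions and a fork instruction that creates two child threads (the parent is suspended until both terminate), together with the atomic test-and-set. Work is the total number of instructions; span is the length of the longest chain of dependent instructions. -}

module Defs where

open import Level using (0ℓ)
open import Algebra.Core using (Op₂)
open import Algebra.Structures using (IsCommutativeMonoid)
import Algebra.Construct.NaturalChoice.Max as Max
import Algebra.Construct.NaturalChoice.Min as Min
open import Data.Fin as Fin using (Fin)
open import Data.Fin.Subset using (Subset; ∣_∣) renaming (_∈_ to _∈ₛ_)
open import Data.Fin.Subset.Properties using () renaming (_∈?_ to _∈ₛ?_)
open import Data.List as List
  using (List; []; _∷_; _++_; length; map; filter; foldr; take; drop; allFin)
import Data.List.Extrema as Extrema
open import Data.List.Membership.Propositional using (_∈_; _∉_)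
open import Data.List.Properties using (length-take; length-drop)
open import Data.List.Relation.Unary.AllPairs using (AllPairs)
open import Data.List.Relation.Unary.Unique.Propositional using (Unique)
open import Data.Maybe using (Maybe; just; nothing)
open import Data.Nat as ℕ using (ℕ; zero; suc; z<s; ⌊_/2⌋)
open import Data.Nat.Induction using (Acc; acc; <-wellFounded)
open import Data.Nat.Logarithm using (⌈log₂_⌉)
open import Data.Nat.Properties as ℕₚ using (⌊n/2⌋<n; m⊓n≤m; ∸-monoʳ-<)
open import Data.Product using (Σ; Σ-syntax; _×_; _,_; proj₁; proj₂)
open import Data.Product.Relation.Binary.Lex.Strict using (×-Lex)
open import Data.Sum using (_⊎_; inj₁; inj₂)
open import Data.Unit using (⊤; tt)
open import Data.Vec.Functional using (Vector)
open import Function.Base using (_∘_; _on_)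
open import Function.Bundles using (_⇔_)
open import Relation.Binary.Bundles using (TotalOrder)
open import Relation.Binary.Core using (Rel)
open import Relation.Binary.Definitions using (Decidable)
import Relation.Binary.Construct.NonStrictToStrict as ToStrict
open import Relation.Binary.PropositionalEquality using (_≡_; _≢_; sym; subst)
open import Relation.Binary.Structures using (IsDecTotalOrder)
open import Relation.Nullary using (Dec; yes; no; ¬?)
open import Relation.Unary using (Pred)

------------------------------------------------------------------------
-- Times and weights.  Only the order of times matters, and weights need
-- only be added and compared, so both are kept abstract.

record LinearOrder : Set₁ where
  infix 4 _≤_
  field
    Carrier         : Set
    _≤_             : Rel Carrier 0ℓ
    isDecTotalOrder : IsDecTotalOrder _≡_ _≤_

  open IsDecTotalOrder isDecTotalOrder public using (_≟_; _≤?_; isTotalOrder)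

  totalOrder : TotalOrder 0ℓ 0ℓ 0ℓ
  totalOrder = record { isTotalOrder = isTotalOrder }

  open ToStrict _≡_ _≤_ public using (_<_)

  _<?_ : Decidable _<_
  _<?_ = ToStrict.<-decidable _≡_ _≤_ _≟_ _≤?_

  open Max totalOrder public using (_⊔_)
  open Min totalOrder public using (_⊓_)
  open Extrema totalOrder public using (max)

-- Weights may be negative: nothing relates 0# to the other elements.

record OrderedWeights : Set₁ where
  field
    linearOrder : LinearOrder

  open LinearOrder linearOrder public

  infixl 6 _+_
  field
    _+_                 : Op₂ Carrier
    0#                  : Carrier
    isCommutativeMonoid : IsCommutativeMonoid _≡_ _+_ 0#
    +-mono-≤            : ∀ {x y u v} → x ≤ y → u ≤ v → (x + u) ≤ (y + v)

IsMaximum : {A : Set} → Rel A 0ℓ → Pred A 0ℓ → A → Set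
IsMaximum _≤_ P m = P m × (∀ x → P x → x ≤ m)

-- Adjoining nothing as an identity: +∞ for a minimum, -∞ for a maximum.

lift : {A : Set} → Op₂ A → Op₂ (Maybe A)
lift _∙_ nothing  y        = y
lift _∙_ (just x) nothing  = just x
lift _∙_ (just x) (just y) = just (x ∙ y)

------------------------------------------------------------------------
-- The activity selection problem.

module _ (T : LinearOrder) (W : OrderedWeights) where
  private
    module T = LinearOrder T
    module W = OrderedWeights W

  record Activity : Set where
    field
      start     : T.Carrier
      end       : T.Carrier
      start<end : start T.< end
      weight    : W.Carrier

module _ {T : LinearOrder} {W : OrderedWeights} where
  private
    module T = LinearOrder T
    module W = OrderedWeights W

  open Activity

  NonOverlapping : Rel (Activity T W) 0ℓ
  NonOverlapping A B = end B T.≤ start A ⊎ end A T.≤ start B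

  module _ {n : ℕ} (S : Vector (Activity T W) n) where

    SortedByEnd : Set
    SortedByEnd = ∀ i j → i Fin.≤ j → end (S i) T.≤ end (S j)

    Feasible : Subset n → Set
    Feasible F = ∀ i j → i ∈ₛ F → j ∈ₛ F → i ≢ j → NonOverlapping (S i) (S j)

    totalWeight : Subset n → W.Carrier
    totalWeight F =
      foldr W._+_ W.0# (map (weight ∘ S) (filter (_∈ₛ? F) (allFin n)))

    IsRank : ℕ → Set
    IsRank = IsMaximum ℕ._≤_ (λ k → Σ[ F ∈ Subset n ] Feasible F × ∣ F ∣ ≡ k)

    IsMaxFeasibleWeight : W.Carrier → Set
    IsMaxFeasibleWeight =
      IsMaximum W._≤_ (λ v → Σ[ F ∈ Subset n ] Feasible F × totalWeight F ≡ v)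

    -- "W.max W.0# vs" is the maximum of 0 and all members of vs.  The
    -- recurrence determines dp, as end (S j) ≤ start (S i) < end (S i).

    IsDP : Vector W.Carrier n → Set
    IsDP dp = ∀ i → dp i ≡ weight (S i) W.+ W.max W.0# (map dp (predecessors i))
      where
      predecessors : Fin n → List (Fin n)
      predecessors i = filter (λ j → end (S j) T.≤? start (S i)) (allFin n)

    Solves : List (Maybe W.Carrier) → Set
    Solves out = Σ[ dp ∈ Vector W.Carrier n ]
      out ≡ List.tabulate (just ∘ dp) ×
      IsDP dp ×
      IsMaxFeasibleWeight (W.max W.0# (List.tabulate dp))

------------------------------------------------------------------------
-- The work-span binary-forking model.  An execution is recorded as the
-- series-parallel graph of the instructions performed, together with the
-- value computed.

infixr 5 _⨾_

data Trace : Set where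
  ε    : Trace
  inst : Trace                       -- a RAM instruction or a test-and-set
  _⨾_  : Trace → Trace → Trace
  fork : Trace → Trace → Trace       -- a fork instruction and its two children

traceWork : Trace → ℕ
traceWork ε          = 0
traceWork inst       = 1
traceWork (p ⨾ q)    = traceWork p ℕ.+ traceWork q
traceWork (fork p q) = suc (traceWork p ℕ.+ traceWork q)

traceSpan : Trace → ℕ
traceSpan ε          = 0
traceSpan inst       = 1
traceSpan (p ⨾ q)    = traceSpan p ℕ.+ traceSpan q
traceSpan (fork p q) = suc (traceSpan p ℕ.⊔ traceSpan q)

record Run (A : Set) : Set where
  constructor run
  field
    value : A
    trace : Trace

open Run public

work span : {A : Set} → Run A → ℕ
work = traceWork ∘ trace
span = traceSpan ∘ trace

private
  variable
    A B X Y : Set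

infixl 1 _>>=_
infixr 2 _∥_

return : A → Run A
return x = run x ε

_>>=_ : Run A → (A → Run B) → Run B
m >>= f = run (value (f (value m))) (trace m ⨾ trace (f (value m)))

instr : A → Run A
instr x = run x inst

_∥_ : Run A → Run B → Run (A × B)
p ∥ q = run (value p , value q) (fork (trace p) (trace q))

-- Lists stand for arrays in shared memory: halving one is an index
-- computation, and the two halves of the result are written in place.

private
  take-half< : ∀ {A : Set} (x y : A) zs → let xs = x ∷ y ∷ zs in
               length (take ⌊ length xs /2⌋ xs) ℕ.< length xs
  take-half< x y zs = let xs = x ∷ y ∷ zs in
    ℕₚ.≤-<-trans
      (subst (ℕ._≤ ⌊ length xs /2⌋) (sym (length-take ⌊ length xs /2⌋ xs))
             (m⊓n≤m _ (length xs)))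
      (⌊n/2⌋<n _)

  drop-half< : ∀ {A : Set} (x y : A) zs → let xs = x ∷ y ∷ zs in
               length (drop ⌊ length xs /2⌋ xs) ℕ.< length xs
  drop-half< x y zs = let xs = x ∷ y ∷ zs in
    subst (ℕ._< length xs) (sym (length-drop ⌊ length xs /2⌋ xs))
          (∸-monoʳ-< {length xs} z<s (ℕₚ.<⇒≤ (⌊n/2⌋<n _)))

parMapAcc : (A → Run B) → (xs : List A) → Acc ℕ._<_ (length xs) → Run (List B)
parMapAcc f []              _        = return []
parMapAcc f (x ∷ [])        _        = do
  y ← f x
  return (y ∷ [])
parMapAcc f xs@(x ∷ y ∷ zs) (acc rs) = do
  _ ← instr ⌊ length xs /2⌋
  us , vs ← parMapAcc f (take ⌊ length xs /2⌋ xs) (rs (take-half< x y zs))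
          ∥ parMapAcc f (drop ⌊ length xs /2⌋ xs) (rs (drop-half< x y zs))
  return (us ++ vs)

parMap : (A → Run B) → List A → Run (List B)
parMap f xs = parMapAcc f xs (<-wellFounded (length xs))

-- A loop whose body either continues with a new state (inj₁) or exits
-- (inj₂).  "Loop body x r" says that, from state x, it terminates with
-- execution r.

data Loop (body : X → Run (X ⊎ Y)) (x : X) : Run Y → Set where
  exit  : ∀ {y} → value (body x) ≡ inj₂ y →
          Loop body x (run y (trace (body x)))
  again : ∀ {x′ r} → value (body x) ≡ inj₁ x′ → Loop body x′ r →
          Loop body x (run (value r) (trace (body x) ⨾ trace r))

------------------------------------------------------------------------
-- Balanced augmented search trees, given by their observable behaviour and
-- their costs.  A tree in Tree n holds entries keyed by a time, ties being
-- broken by an index below n, and is augmented with the ∙-sum of its values.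
-- The constant in the cost bounds is uniform in n; 1+log₂ replaces the
-- logarithm so that the bounds also make sense for trees of size 0 and 1.

1+log₂ : ℕ → ℕ
1+log₂ m = suc ⌈log₂ m ⌉

data Range (A : Set) : Set where
  everything : Range A
  upTo       : A → Range A

module _ (T : LinearOrder) where
  private
    module T = LinearOrder T

  Key : ℕ → Set
  Key n = T.Carrier × Fin n

  _<ₖ_ : ∀ {n} → Rel (Key n) 0ℓ
  _<ₖ_ = ×-Lex _≡_ T._<_ Fin._<_

  InRange : Range T.Carrier → Pred T.Carrier 0ℓ
  InRange everything _ = ⊤
  InRange (upTo τ)   t = t T.≤ τ

  inRange? : ∀ ρ t → Dec (InRange ρ t)
  inRange? everything _ = yes tt
  inRange? (upTo τ)   t = t T.≤? τ

  record AugmentedTrees {V : Set} (_∙_ : Op₂ V) (ε∙ : V) : Set₁ where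

    Entry : ℕ → Set
    Entry n = Key n × V

    time : ∀ {n} → Entry n → T.Carrier
    time = proj₁ ∘ proj₁

    SortedByKey : ∀ {n} → List (Entry n) → Set
    SortedByKey = AllPairs (_<ₖ_ on proj₁)

    field
      Tree    : ℕ → Set
      entries : ∀ {n} → Tree n → List (Entry n)
      sorted  : ∀ {n} (t : Tree n) → SortedByKey (entries t)

    size : ∀ {n} → Tree n → ℕ
    size = length ∘ entries

    -- update inserts each of the given entries, overwriting the entry with
    -- the same key if there is one.  Its cost is stated in terms of the
    -- number of entries of the updated tree.

    field
      build   : ∀ {n} → List (Entry n) → Run (Tree n)
      flatten : ∀ {n} → Tree n → Run (List (Entry n))
      split   : ∀ {n} → T.Carrier → Tree n → Run (Tree n × Tree n)
      query   : ∀ {n} → Range T.Carrier → Tree n → Run V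
      update  : ∀ {n} → List (Entry n) → Tree n → Run (Tree n)

      build-entries : ∀ {n} (es : List (Entry n)) → SortedByKey es →
        entries (value (build es)) ≡ es
      flatten-value : ∀ {n} (t : Tree n) → value (flatten t) ≡ entries t
      split-entries₁ : ∀ {n} τ (t : Tree n) →
        entries (proj₁ (value (split τ t))) ≡
        filter (λ e → time e T.<? τ) (entries t)
      split-entries₂ : ∀ {n} τ (t : Tree n) →
        entries (proj₂ (value (split τ t))) ≡
        filter (λ e → ¬? (time e T.<? τ)) (entries t)
      query-value : ∀ {n} ρ (t : Tree n) →
        value (query ρ t) ≡
        foldr _∙_ ε∙ (map proj₂ (filter (inRange? ρ ∘ time) (entries t)))
      update-entries : ∀ {n} (es : List (Entry n)) (t : Tree n) →
        Unique (map proj₁ es) → ∀ e →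
        e ∈ entries (value (update es t)) ⇔
        (e ∈ es ⊎ (e ∈ entries t × proj₁ e ∉ map proj₁ es))

      c : ℕ

      build-work : ∀ {n} (es : List (Entry n)) → SortedByKey es →
        work (build es) ℕ.≤ c ℕ.* suc (length es)
      build-span : ∀ {n} (es : List (Entry n)) → SortedByKey es →
        span (build es) ℕ.≤ c ℕ.* 1+log₂ (length es)
      flatten-work : ∀ {n} (t : Tree n) → work (flatten t) ℕ.≤ c ℕ.* suc (size t)
      flatten-span : ∀ {n} (t : Tree n) → span (flatten t) ℕ.≤ c ℕ.* 1+log₂ (size t)
      split-work : ∀ {n} τ (t : Tree n) → work (split τ t) ℕ.≤ c ℕ.* 1+log₂ (size t)
      query-work : ∀ {n} ρ (t : Tree n) → work (query ρ t) ℕ.≤ c ℕ.* 1+log₂ (size t)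
      update-work : ∀ {n} (es : List (Entry n)) (t : Tree n) →
        Unique (map proj₁ es) →
        work (update es t) ℕ.≤
        c ℕ.* (suc (length es) ℕ.* 1+log₂ (size (value (update es t))))
      update-span : ∀ {n} (es : List (Entry n)) (t : Tree n) →
        Unique (map proj₁ es) →
        span (update es t) ℕ.≤ c ℕ.* 1+log₂ (size (value (update es t)))

------------------------------------------------------------------------
-- The algorithm.

-- Keyed by start time, valued by end time, augmented with the minimum.

TimeTrees : LinearOrder → Set₁
TimeTrees T = AugmentedTrees T (lift (LinearOrder._⊓_ T)) nothing

-- Keyed by end time, valued by the DP value (nothing if not yet computed),
-- augmented with the maximum.

DPTrees : LinearOrder → OrderedWeights → Set₁
DPTrees T W = AugmentedTrees T (lift (OrderedWeights._⊔_ W)) nothing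

module Type1 {T : LinearOrder} {W : OrderedWeights}
             (timeTrees : TimeTrees T) (dpTrees : DPTrees T W)
             {n : ℕ} (S : Vector (Activity T W) n) where
  private
    module T  = LinearOrder T
    module W  = OrderedWeights W
    module TT = AugmentedTrees timeTrees
    module DT = AugmentedTrees dpTrees

  open Activity

  State : Set
  State = TT.Tree n × DT.Tree n

  dpEntry : Fin n → Run (DT.Entry n)
  dpEntry i = do
    e ← instr (end (S i))
    instr ((e , i) , nothing)

  timeEntry : Fin n → Run (TT.Entry n)
  timeEntry i = do
    s ← instr (start (S i))
    e ← instr (end (S i))
    instr ((s , i) , just e)

  -- S is sorted by end time, so the DP tree is built directly from it.  The
  -- start times come in no particular order, so the time tree is obtained by
  -- a batch of insertions into the empty tree.

  initialise : Run State
  initialise = do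
    des ← parMap dpEntry (allFin n)
    tdp ← DT.build des
    tes ← parMap timeEntry (allFin n)
    t₀  ← TT.build []
    tt₀ ← TT.update tes t₀
    return (tt₀ , tdp)

  max₀ : Maybe W.Carrier → W.Carrier
  max₀ nothing  = W.0#
  max₀ (just v) = W.0# W.⊔ v

  computeDP : DT.Tree n → TT.Entry n → Run (DT.Entry n)
  computeDP tdp ((s , i) , _) = do
    q ← DT.query (upTo s) tdp
    b ← instr (max₀ q)
    w ← instr (weight (S i))
    v ← instr (w W.+ b)
    e ← instr (end (S i))
    instr ((e , i) , just v)

  -- The minimum end time is nothing exactly when no activity is left.

  processFrontier : State → Maybe T.Carrier → Run (State ⊎ DT.Tree n)
  processFrontier (ttime , tdp) nothing   = return (inj₂ tdp)
  processFrontier (ttime , tdp) (just e*) = do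
    frontier , rest ← TT.split e* ttime
    es   ← TT.flatten frontier
    us   ← parMap (computeDP tdp) es
    tdp′ ← DT.update us tdp
    return (inj₁ (rest , tdp′))

  round : State → Run (State ⊎ DT.Tree n)
  round (ttime , tdp) = do
    m  ← TT.query everything ttime
    m′ ← instr m
    processFrontier (ttime , tdp) m′

  -- Entries of the DP tree are in order of end time, hence of index.

  output : DT.Tree n → Run (List (Maybe W.Carrier))
  output tdp = do
    es ← DT.flatten tdp
    parMap (instr ∘ proj₂) es

  Executes : Run (List (Maybe W.Carrier)) → Set
  Executes r = Σ[ rounds ∈ Run (DT.Tree n) ]
    Loop round (value initialise) rounds ×
    r ≡ (initialise >>= λ _ → rounds >>= output)

{-# OPTIONS --safe #-}

-- Correctness.  Every predecessor j of a frontier activity i (end j ≤ start i) ends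
-- before e*, the earliest end of an unprocessed activity, so it has been processed;
-- hence the range query returns exactly the maximum in the recurrence.
--
-- Cost.  The activities that survive a round start at or after e*, so the
-- earliest-end activities of the successive rounds do not overlap and there are at
-- most rank(S) rounds, each of span O(log n).  Every round processes m ≥ 1
-- activities with work O(m log n), and the frontiers partition the n activities.

module Submission where

open import Defs
open import Data.Nat
  using (ℕ; _≤_; _*_; zero; suc; _<_; _+_; _∸_; _⊔_; z≤n; s≤s; ⌊_/2⌋; ⌈_/2⌉; _<?_)
open import Data.Nat.Logarithm using (⌈log₂_⌉; ⌈log₂⌉-mono-≤; ⌈log₂⌈n/2⌉⌉≡⌈log₂n⌉∸1)
open import Data.List as List
  using (List; []; _∷_; _++_; length; map; filter; foldr; take; drop; allFin; lookup)
open import Data.Maybe using (Maybe; just; nothing)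
open import Data.Product using (Σ-syntax; _×_; _,_; proj₁; proj₂)
open import Data.Vec.Functional using (Vector)
open import Algebra.Core using (Op₂)
open import Algebra.Structures using (IsCommutativeMonoid)
import Algebra.Construct.NaturalChoice.Max as Max
import Algebra.Construct.NaturalChoice.MaxOp as MaxOp
import Algebra.Construct.NaturalChoice.Min as Min
import Algebra.Construct.NaturalChoice.MinOp as MinOp
open import Data.Bool using (true; false; if_then_else_)
open import Data.Fin as Fin using (Fin; toℕ)
import Data.Fin.Properties as Finₚ
open import Data.Fin.Subset using (Subset; ∣_∣; _∪_; ⁅_⁆)
  renaming (_∈_ to _∈ₛ_; _∉_ to _∉ₛ_; ⊥ to ∅)
open import Data.Fin.Subset.Properties
  using (x∈p∪q⁻; p⊆p∪q; q⊆p∪q; x∈⁅x⁆; x∈⁅y⁆⇒x≡y; ∉⊥; p⊂q⇒∣p∣<∣q∣)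
  renaming (_∈?_ to _∈ₛ?_)
import Data.List.Extrema as Extrema
import Data.List.Membership.DecPropositional as DecMembership
open import Data.List.Membership.Propositional using (_∈_; _∉_)
open import Data.List.Membership.Propositional.Properties
  using (∈-filter⁺; ∈-filter⁻; ∈-map⁺; ∈-map⁻; ∈-allFin; ∈-tabulate⁺; ∈-tabulate⁻; ∈-lookup)
open import Data.List.Properties
  using (map-cong; map-cong-local; map-∘; map-++; map-id-local; map-tabulate; filter-all; filter-none;
         length-map; length-tabulate; length-++; length-take; length-drop; take++drop≡id)
open import Data.List.Relation.Unary.All as All using (All; []; _∷_)
import Data.List.Relation.Unary.All.Properties as Allₚ
open import Data.List.Relation.Unary.AllPairs as AllPairs using (AllPairs; []; _∷_)
import Data.List.Relation.Unary.AllPairs.Properties as AllPairsₚ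
open import Data.List.Relation.Unary.Any using (here; there)
open import Data.List.Relation.Unary.Unique.Propositional using (Unique)
open import Data.List.Relation.Unary.Unique.Propositional.Properties using (allFin⁺; filter⁺; map⁺)
open import Data.Nat.Induction using (Acc; acc)
import Data.Nat.Properties as ℕₚ
open import Data.Nat.Tactic.RingSolver using (solve-∀)
open import Data.Sum using (_⊎_; inj₁; inj₂; swap)
open import Data.Unit using (tt)
open import Function.Base using (_∘_; id)
open import Function.Bundles using (Equivalence)
open import Level using (0ℓ)
open import Relation.Binary.Core using (Rel)
open import Relation.Binary.Definitions using (Transitive; Asymmetric)
open import Relation.Binary.PropositionalEquality
  using (_≡_; _≢_; refl; sym; trans; cong; cong₂; subst; subst₂; module ≡-Reasoning)
open import Relation.Binary.Structures using (IsTotalOrder)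
open import Relation.Nullary using (yes; no; does; ¬_; ¬?; contradiction)
open import Relation.Nullary.Decidable using (dec-true; dec-false)
open import Relation.Unary using (Pred; Decidable)

-- The trees are known only through their entry lists and cost bounds, and an update is specified
-- only up to membership. Strict key order turns membership into equality of entry lists, so that
-- the list of pending indices alone describes a state. The DP values are constructed apart from any
-- execution, by iterating the recurrence. Optimality is then a statement about the recurrence, and
-- the run has only to be shown to store these values. `Loop` is inductive, so exhibiting an
-- execution also proves termination. The feasible set that counts the rounds grows from the last
-- round back to the first: what it already holds starts no earlier than the end of the activity
-- added next. Initialisation, output and the final round on an empty time tree cost extra. The
-- hypothesis `2 ≤ n` absorbs them, since it makes both the logarithm and the rank at least 1.

-- Lists: filters, uniqueness of sorted lists, extrema as folds.

filter-map : {A B : Set} {P : Pred B 0ℓ} (P? : Decidable P) (f : A → B) (xs : List A) →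
             filter P? (map f xs) ≡ map f (filter (P? ∘ f) xs)
filter-map P? f []       = refl
filter-map P? f (x ∷ xs) with does (P? (f x))
... | true  = cong (f x ∷_) (filter-map P? f xs)
... | false = filter-map P? f xs

length-filter-∁ : {A : Set} {P : Pred A 0ℓ} (P? : Decidable P) (xs : List A) →
                  length (filter P? xs) + length (filter (¬? ∘ P?) xs) ≡ length xs
length-filter-∁ P? []       = refl
length-filter-∁ P? (x ∷ xs) with does (P? x)
... | true  = cong suc (length-filter-∁ P? xs)
... | false = trans (ℕₚ.+-suc _ _) (cong suc (length-filter-∁ P? xs))

-- If the heads differed, each would lie in the other list's tail, giving both `x ≺ y` and `y ≺ x`.
-- Asymmetry also makes the order irreflexive, so a head never recurs in its tail and the inclusions
-- pass to the tails.
sorted-unique : {A : Set} {_≺_ : Rel A 0ℓ} → Asymmetric _≺_ → {xs ys : List A} →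
                AllPairs _≺_ xs → AllPairs _≺_ ys →
                (∀ {z} → z ∈ xs → z ∈ ys) → (∀ {z} → z ∈ ys → z ∈ xs) → xs ≡ ys
sorted-unique asym {[]}     {[]}     _ _ _ _ = refl
sorted-unique asym {[]}     {y ∷ ys} _ _ _ ⊇ with () ← ⊇ (here refl)
sorted-unique asym {x ∷ xs} {[]}     _ _ ⊆ _ with () ← ⊆ (here refl)
sorted-unique {_≺_ = _≺_} asym {x ∷ xs} {y ∷ ys} (x≺ ∷ xs!) (y≺ ∷ ys!) ⊆ ⊇ =
  cong₂ _∷_ x≡y (sorted-unique asym xs! ys!
    (λ z∈xs → tail x≡y x≺ z∈xs (⊆ (there z∈xs)))
    (λ z∈ys → tail (sym x≡y) y≺ z∈ys (⊇ (there z∈ys))))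
  where
  x≡y : x ≡ y
  x≡y with ⊆ (here refl) | ⊇ (here refl)
  ... | here eq    | _          = eq
  ... | there _    | here eq    = sym eq
  ... | there x∈ys | there y∈xs =
    contradiction (All.lookup y≺ x∈ys) (asym (All.lookup x≺ y∈xs))
  tail : ∀ {u v us vs z} → u ≡ v → All (u ≺_) us → z ∈ us → z ∈ v ∷ vs → z ∈ vs
  tail refl u≺ z∈us (here refl)  =
    contradiction (All.lookup u≺ z∈us) (asym (All.lookup u≺ z∈us))
  tail _    _  _    (there z∈vs) = z∈vs

lookup-injective : {A : Set} {xs : List A} → Unique xs →
                   ∀ {i j} → lookup xs i ≡ lookup xs j → i ≡ j
lookup-injective (_    ∷ _)   {Fin.zero}  {Fin.zero}  _  = refl
lookup-injective (x≢xs ∷ _)   {Fin.zero}  {Fin.suc j} eq =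
  contradiction eq (All.lookup x≢xs (∈-lookup j))
lookup-injective (x≢xs ∷ _)   {Fin.suc i} {Fin.zero}  eq =
  contradiction (sym eq) (All.lookup x≢xs (∈-lookup i))
lookup-injective (_    ∷ xs!) {Fin.suc i} {Fin.suc j} eq =
  cong Fin.suc (lookup-injective xs! eq)

-- Pigeonhole on positions. It keeps the logarithm of every frontier and of every time tree below
-- that of `n`.
unique⇒length≤ : ∀ {n} {is : List (Fin n)} → Unique is → length is ≤ n
unique⇒length≤ is! = Finₚ.injective⇒≤ (lookup-injective is!)

-- Taken with `_≤_` this is a minimum, with the reversed order a maximum, so one fold lemma serves
-- both kinds of tree.
IsExtremum : {A : Set} → Rel A 0ℓ → List A → Maybe A → Set
IsExtremum _≼_ xs nothing  = xs ≡ []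
IsExtremum _≼_ xs (just m) = m ∈ xs × All (m ≼_) xs

foldr-lift-isExtremum :
  {A : Set} {_≼_ : Rel A 0ℓ} (_∙_ : Op₂ A) → Transitive _≼_ → (∀ x → x ≼ x) →
  (∀ x y → (x ∙ y) ≼ x) → (∀ x y → (x ∙ y) ≼ y) →
  (∀ x y → (x ∙ y) ≡ x ⊎ (x ∙ y) ≡ y) →
  ∀ xs → IsExtremum _≼_ xs (foldr (lift _∙_) nothing (map just xs))
foldr-lift-isExtremum _∙_ ≼-trans ≼-refl ∙≼ˡ ∙≼ʳ sel [] = refl
foldr-lift-isExtremum _∙_ ≼-trans ≼-refl ∙≼ˡ ∙≼ʳ sel (x ∷ xs)
  with foldr (lift _∙_) nothing (map just xs)
     | foldr-lift-isExtremum _∙_ ≼-trans ≼-refl ∙≼ˡ ∙≼ʳ sel xs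
... | nothing | refl       = here refl , ≼-refl x ∷ []
... | just m  | m∈xs , m≼ =
  member (sel x m) , ∙≼ˡ x m ∷ All.map (≼-trans (∙≼ʳ x m)) m≼
  where
  member : (x ∙ m) ≡ x ⊎ (x ∙ m) ≡ m → (x ∙ m) ∈ x ∷ xs
  member (inj₁ eq) = here eq
  member (inj₂ eq) = there (subst (_∈ xs) (sym eq) m∈xs)

-- The ring solver proves equations only, so each numeric bound is an equation with
-- an explicit slack o.
≡+⇒≤ : ∀ {m n} o → n ≡ m + o → m ≤ n
≡+⇒≤ {m} o refl = ℕₚ.m≤m+n m o

-- Work and span of traces and of the parallel map.

-- Splits and queries come with work bounds only; this supplies their spans, and the span of the
-- body of a parallel map.
traceSpan≤traceWork : ∀ t → traceSpan t ≤ traceWork t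
traceSpan≤traceWork ε          = z≤n
traceSpan≤traceWork inst       = ℕₚ.≤-refl
traceSpan≤traceWork (p ⨾ q)    = ℕₚ.+-mono-≤ (traceSpan≤traceWork p) (traceSpan≤traceWork q)
traceSpan≤traceWork (fork p q) = s≤s (ℕₚ.⊔-lub
  (ℕₚ.≤-trans (traceSpan≤traceWork p) (ℕₚ.m≤m+n _ _))
  (ℕₚ.≤-trans (traceSpan≤traceWork q) (ℕₚ.m≤n+m _ _)))

module _ {A B : Set} (f : A → Run B) where

  parMapAcc-value : ∀ xs (a : Acc _<_ (length xs)) →
                    value (parMapAcc f xs a) ≡ map (value ∘ f) xs
  parMapAcc-value []              _        = refl
  parMapAcc-value (x ∷ [])        _        = refl
  parMapAcc-value xs@(x ∷ y ∷ zs) (acc rs) =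
    trans (cong₂ _++_ (parMapAcc-value (take h xs) _) (parMapAcc-value (drop h xs) _))
          (trans (sym (map-++ (value ∘ f) (take h xs) (drop h xs)))
                 (cong (map (value ∘ f)) (take++drop≡id h xs)))
    where h = ⌊ length xs /2⌋

  parMap-value : ∀ xs → value (parMap f xs) ≡ map (value ∘ f) xs
  parMap-value xs = parMapAcc-value xs _

  module _ (b : ℕ) (f-work : ∀ x → work (f x) ≤ b) where

    private
      take-length : ∀ (xs : List A) → length (take ⌊ length xs /2⌋ xs) ≡ ⌊ length xs /2⌋
      take-length xs = trans (length-take ⌊ length xs /2⌋ xs)
                             (ℕₚ.m≤n⇒m⊓n≡m (ℕₚ.⌊n/2⌋≤n (length xs)))

      drop-length : ∀ (xs : List A) → length (drop ⌊ length xs /2⌋ xs) ≡ ⌈ length xs /2⌉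
      drop-length xs = trans (length-drop ⌊ length xs /2⌋ xs) (begin
        length xs ∸ ⌊ length xs /2⌋
          ≡⟨ cong (_∸ ⌊ length xs /2⌋) (sym (ℕₚ.⌊n/2⌋+⌈n/2⌉≡n (length xs))) ⟩
        ⌊ length xs /2⌋ + ⌈ length xs /2⌉ ∸ ⌊ length xs /2⌋
          ≡⟨ ℕₚ.m+n∸m≡n ⌊ length xs /2⌋ ⌈ length xs /2⌉ ⟩
        ⌈ length xs /2⌉ ∎)
        where open ≡-Reasoning

    -- A binary tree with m leaves has m - 1 inner nodes, each costing two
    -- instructions; the slack of 2 carries the induction.
    parMapAcc-work : ∀ xs (a : Acc _<_ (length xs)) → 1 ≤ length xs →
                     2 + work (parMapAcc f xs a) ≤ (2 + b) * length xs
    parMapAcc-work (x ∷ [])        _        _ = begin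
      2 + (work (f x) + 0) ≡⟨ cong (2 +_) (ℕₚ.+-identityʳ _) ⟩
      2 + work (f x)       ≤⟨ ℕₚ.+-monoʳ-≤ 2 (f-work x) ⟩
      2 + b                ≡⟨ ℕₚ.*-identityʳ (2 + b) ⟨
      (2 + b) * 1          ∎
      where open ℕₚ.≤-Reasoning
    parMapAcc-work xs@(x ∷ y ∷ zs) (acc rs) _ = begin
      2 + (1 + (1 + (wˡ + wʳ) + 0))  ≡⟨ rearrange wˡ wʳ ⟩
      (2 + wˡ) + (2 + wʳ)
        ≤⟨ ℕₚ.+-mono-≤
             (parMapAcc-work (take h xs) _ (subst (1 ≤_) (sym (take-length xs)) (s≤s z≤n)))
             (parMapAcc-work (drop h xs) _ (subst (1 ≤_) (sym (drop-length xs)) (s≤s z≤n))) ⟩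
      (2 + b) * length (take h xs) + (2 + b) * length (drop h xs)
        ≡⟨ ℕₚ.*-distribˡ-+ (2 + b) (length (take h xs)) (length (drop h xs)) ⟨
      (2 + b) * (length (take h xs) + length (drop h xs))
        ≡⟨ cong ((2 + b) *_) (trans (sym (length-++ (take h xs)))
                                    (cong length (take++drop≡id h xs))) ⟩
      (2 + b) * length xs            ∎
      where
      open ℕₚ.≤-Reasoning
      h = ⌊ length xs /2⌋
      wˡ = work (parMapAcc f (take h xs) _)
      wʳ = work (parMapAcc f (drop h xs) _)
      rearrange : ∀ u v → 2 + (1 + (1 + (u + v) + 0)) ≡ (2 + u) + (2 + v)
      rearrange = solve-∀

    parMap-work : ∀ xs → work (parMap f xs) ≤ (2 + b) * length xs
    parMap-work []       = z≤n
    parMap-work (x ∷ xs) = ℕₚ.≤-trans (ℕₚ.m≤n+m _ 2) (parMapAcc-work (x ∷ xs) _ (s≤s z≤n))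

    -- Each level of halving adds two instructions to the critical path, the index computation and
    -- the fork. The larger half has `⌈ m /2⌉` elements, which lowers the rounded logarithm by
    -- exactly one.
    parMapAcc-span : ∀ xs (a : Acc _<_ (length xs)) →
                     span (parMapAcc f xs a) ≤ 2 * ⌈log₂ length xs ⌉ + b
    parMapAcc-span []              _        = z≤n
    parMapAcc-span (x ∷ [])        _        =
      subst (_≤ b) (sym (ℕₚ.+-identityʳ _))
            (ℕₚ.≤-trans (traceSpan≤traceWork (trace (f x))) (f-work x))
    parMapAcc-span xs@(x ∷ y ∷ zs) (acc rs) = begin
      1 + (1 + (sˡ ⊔ sʳ) + 0)  ≡⟨ cong suc (ℕₚ.+-identityʳ _) ⟩
      2 + (sˡ ⊔ sʳ)
        ≤⟨ ℕₚ.+-monoʳ-≤ 2 (ℕₚ.⊔-lub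
             (ℕₚ.≤-trans (parMapAcc-span (take h xs) _)
                         (half-bound (ℕₚ.≤-trans (ℕₚ.≤-reflexive (take-length xs))
                                                 (ℕₚ.⌊n/2⌋≤⌈n/2⌉ (length xs)))))
             (ℕₚ.≤-trans (parMapAcc-span (drop h xs) _)
                         (half-bound (ℕₚ.≤-reflexive (drop-length xs))))) ⟩
      2 + (2 * (⌈log₂ length xs ⌉ ∸ 1) + b) ≡⟨ ℕₚ.+-assoc 2 _ b ⟨
      2 + 2 * (⌈log₂ length xs ⌉ ∸ 1) + b
        ≡⟨ cong (_+ b) (ℕₚ.*-distribˡ-+ 2 1 (⌈log₂ length xs ⌉ ∸ 1)) ⟨
      2 * (1 + (⌈log₂ length xs ⌉ ∸ 1)) + b
        -- With at least two elements the logarithm is at least 1, so the truncated subtraction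
        -- loses nothing.
        ≡⟨ cong (λ k → 2 * k + b) (ℕₚ.m+[n∸m]≡n (⌈log₂⌉-mono-≤ {2} {length xs} (s≤s (s≤s z≤n)))) ⟩
      2 * ⌈log₂ length xs ⌉ + b ∎
      where
      open ℕₚ.≤-Reasoning
      h = ⌊ length xs /2⌋
      sˡ = span (parMapAcc f (take h xs) _)
      sʳ = span (parMapAcc f (drop h xs) _)
      half-bound : ∀ {m} → m ≤ ⌈ length xs /2⌉ →
                   2 * ⌈log₂ m ⌉ + b ≤ 2 * (⌈log₂ length xs ⌉ ∸ 1) + b
      half-bound m≤ = ℕₚ.+-monoˡ-≤ b (ℕₚ.*-monoʳ-≤ 2 (ℕₚ.≤-trans (⌈log₂⌉-mono-≤ m≤)
        (ℕₚ.≤-reflexive (⌈log₂⌈n/2⌉⌉≡⌈log₂n⌉∸1 (length xs)))))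

    parMap-span : ∀ xs → span (parMap f xs) ≤ 2 * ⌈log₂ length xs ⌉ + b
    parMap-span xs = parMapAcc-span xs _

-- Linear orders.

module LinearOrderProperties (O : LinearOrder) where
  private module O = LinearOrder O
  open IsTotalOrder O.isTotalOrder public
    using (total) renaming (refl to ≤-refl; trans to ≤-trans; antisym to ≤-antisym)
  open Max O.totalOrder using (maxOperator)
  open Min O.totalOrder using (minOperator)
  open MaxOp maxOperator public using (x≤x⊔y; x≤y⊔x; ⊔-sel)
  open MinOp minOperator public using (x⊓y≤x; x⊓y≤y; ⊓-sel)
  open Extrema O.totalOrder public using (argmax-sel; max≤v⁺; ⊥≤max; xs≤max)

  <⇒≱ : ∀ {x y} → x O.< y → ¬ (y O.≤ x)
  <⇒≱ (x≤y , x≢y) y≤x = x≢y (≤-antisym x≤y y≤x)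

  ≮⇒≥ : ∀ {x y} → ¬ (x O.< y) → y O.≤ x
  ≮⇒≥ {x} {y} x≮y with x O.≟ y | total x y
  ... | yes x≡y | _        = subst (O._≤ x) x≡y ≤-refl
  ... | no  _   | inj₂ y≤x = y≤x
  ... | no  x≢y | inj₁ x≤y = contradiction (x≤y , x≢y) x≮y

  ⊓-minimum : ∀ xs → IsExtremum O._≤_ xs (foldr (lift O._⊓_) nothing (map just xs))
  ⊓-minimum = foldr-lift-isExtremum O._⊓_ ≤-trans (λ _ → ≤-refl) x⊓y≤x x⊓y≤y ⊓-sel

  ⊔-maximum : ∀ xs → IsExtremum (λ x y → y O.≤ x) xs (foldr (lift O._⊔_) nothing (map just xs))
  ⊔-maximum = foldr-lift-isExtremum O._⊔_ (λ y≤x z≤y → ≤-trans z≤y y≤x) (λ _ → ≤-refl)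
    x≤x⊔y x≤y⊔x ⊔-sel

  ⊔-lub : ∀ {x y z} → x O.≤ z → y O.≤ z → (x O.⊔ y) O.≤ z
  ⊔-lub {x} {y} {z} x≤z y≤z with ⊔-sel x y
  ... | inj₁ eq = subst (O._≤ z) (sym eq) x≤z
  ... | inj₂ eq = subst (O._≤ z) (sym eq) y≤z

-- Existence of the DP values and optimality of their maximum.

module ActivityProperties {T : LinearOrder} {W : OrderedWeights}
                          {n : ℕ} (S : Vector (Activity T W) n) (sortedS : SortedByEnd S) where
  module T  = LinearOrder T
  module W  = OrderedWeights W
  module Tₚ = LinearOrderProperties T
  module Wₚ = LinearOrderProperties W.linearOrder
  open IsCommutativeMonoid W.isCommutativeMonoid using (assoc; comm; identityʳ)
  open Activity

  predecessors : Fin n → List (Fin n)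
  predecessors i = filter (λ j → end (S j) T.≤? start (S i)) (allFin n)

  predecessor⇒end≤start : ∀ {i j} → j ∈ predecessors i → end (S j) T.≤ start (S i)
  predecessor⇒end≤start {i} j∈ =
    proj₂ (∈-filter⁻ (λ j → end (S j) T.≤? start (S i)) {xs = allFin n} j∈)

  end≤start⇒predecessor : ∀ {i j} → end (S j) T.≤ start (S i) → j ∈ predecessors i
  end≤start⇒predecessor {i} {j} = ∈-filter⁺ (λ j → end (S j) T.≤? start (S i)) (∈-allFin j)

  start≤end : ∀ i → start (S i) T.≤ end (S i)
  start≤end i = proj₁ (start<end (S i))

  -- Otherwise sortedness gives `end (S i) ≤ end (S j) ≤ start (S i)`, against `start<end`. The
  -- recurrence thus descends along the index.
  end≤start⇒< : ∀ {i j} → end (S j) T.≤ start (S i) → j Fin.< i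
  end≤start⇒< {i} {j} ej≤si with toℕ j <? toℕ i
  ... | yes j<i = j<i
  ... | no  j≮i = contradiction (Tₚ.≤-trans (sortedS i j (ℕₚ.≮⇒≥ j≮i)) ej≤si)
                                (Tₚ.<⇒≱ (start<end (S i)))

  recurrence : Vector W.Carrier n → Vector W.Carrier n
  recurrence d i = weight (S i) W.+ W.max W.0# (map d (predecessors i))

  -- The recurrence is not structurally recursive, so it is iterated from an arbitrary constant.
  -- After `k` steps the values at indices below `k` are final, hence `n` steps reach a fixed point.
  iterate : ℕ → Vector W.Carrier n
  iterate zero    _ = W.0#
  iterate (suc k)   = recurrence (iterate k)

  iterate-stable : ∀ k i → toℕ i < k → iterate k i ≡ iterate (suc k) i
  iterate-stable (suc k) i (s≤s i≤k) =
    cong (λ vs → weight (S i) W.+ W.max W.0# vs)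
         (map-cong-local (All.tabulate λ {j} j∈ → iterate-stable k j
           (ℕₚ.<-≤-trans (end≤start⇒< {i} {j} (predecessor⇒end≤start {i} j∈)) i≤k)))

  dp : Vector W.Carrier n
  dp = iterate n

  dp-isDP : IsDP S dp
  dp-isDP i = iterate-stable n i (Finₚ.toℕ<n i)

  sumWeights : List (Fin n) → W.Carrier
  sumWeights = foldr W._+_ W.0# ∘ map (weight ∘ S)

  Compatible : Subset n → Fin n → Set
  Compatible F i = ∀ j → j ∈ₛ F → NonOverlapping (S i) (S j)

  ∅-feasible : Feasible S ∅
  ∅-feasible i j i∈ = contradiction i∈ ∉⊥

  ∪-feasible : ∀ {F i} → Feasible S F → Compatible F i → Feasible S (F ∪ ⁅ i ⁆)
  ∪-feasible {F} {i} feas compat j k j∈ k∈ j≢k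
    with x∈p∪q⁻ F ⁅ i ⁆ j∈ | x∈p∪q⁻ F ⁅ i ⁆ k∈
  ... | inj₁ j∈F | inj₁ k∈F = feas j k j∈F k∈F j≢k
  ... | inj₁ j∈F | inj₂ k∈i =
    subst (λ l → NonOverlapping (S j) (S l)) (sym (x∈⁅y⁆⇒x≡y i k∈i)) (swap (compat j j∈F))
  ... | inj₂ j∈i | inj₁ k∈F =
    subst (λ l → NonOverlapping (S l) (S k)) (sym (x∈⁅y⁆⇒x≡y i j∈i)) (compat k k∈F)
  ... | inj₂ j∈i | inj₂ k∈i =
    contradiction (trans (x∈⁅y⁆⇒x≡y i j∈i) (sym (x∈⁅y⁆⇒x≡y i k∈i))) j≢k

  ∣∪∣ : ∀ {F : Subset n} {i} → i ∉ₛ F → ∣ F ∣ < ∣ F ∪ ⁅ i ⁆ ∣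
  ∣∪∣ {F} {i} i∉F = p⊂q⇒∣p∣<∣q∣ (p⊆p∪q ⁅ i ⁆ , i , q⊆p∪q F ⁅ i ⁆ (x∈⁅x⁆ i) , i∉F)

  totalWeight-∅ : totalWeight S ∅ ≡ W.0#
  totalWeight-∅ = cong sumWeights (filter-none (_∈ₛ? ∅) (All.universal (λ _ → ∉⊥) (allFin n)))

  module _ {F : Subset n} {i : Fin n} (i∉F : i ∉ₛ F) where

    private
      ∪⁻ : ∀ {j} → i ≢ j → j ∈ₛ F ∪ ⁅ i ⁆ → j ∈ₛ F
      ∪⁻ i≢j j∈ with x∈p∪q⁻ F ⁅ i ⁆ j∈
      ... | inj₁ j∈F = j∈F
      ... | inj₂ j∈i = contradiction (sym (x∈⁅y⁆⇒x≡y i j∈i)) i≢j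

    filter-∪-∉ : ∀ {xs} → All (i ≢_) xs → filter (_∈ₛ? (F ∪ ⁅ i ⁆)) xs ≡ filter (_∈ₛ? F) xs
    filter-∪-∉ [] = refl
    filter-∪-∉ {x ∷ xs} (i≢x ∷ i≢xs) with x ∈ₛ? (F ∪ ⁅ i ⁆) | x ∈ₛ? F
    ... | yes _  | yes _  = cong (x ∷_) (filter-∪-∉ i≢xs)
    ... | no  _  | no  _  = filter-∪-∉ i≢xs
    ... | yes x∈ | no  x∉ = contradiction (∪⁻ i≢x x∈) x∉
    ... | no  x∉ | yes x∈ = contradiction (p⊆p∪q ⁅ i ⁆ x∈) x∉

    -- The new index may stand anywhere in the list: commutativity moves its weight past those
    -- before it, and uniqueness ensures that it is counted once.
    sumWeights-∪ : ∀ {xs} → Unique xs → i ∈ xs →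
      sumWeights (filter (_∈ₛ? (F ∪ ⁅ i ⁆)) xs) ≡
      weight (S i) W.+ sumWeights (filter (_∈ₛ? F) xs)
    sumWeights-∪ {x ∷ xs} (x≢xs ∷ _) (here refl) with i ∈ₛ? (F ∪ ⁅ i ⁆) | i ∈ₛ? F
    ... | yes _  | no  _  = cong (λ ys → weight (S i) W.+ sumWeights ys) (filter-∪-∉ x≢xs)
    ... | no  i∉ | _      = contradiction (q⊆p∪q F ⁅ i ⁆ (x∈⁅x⁆ i)) i∉
    ... | _      | yes i∈ = contradiction i∈ i∉F
    sumWeights-∪ {x ∷ xs} (x≢xs ∷ xs!) (there i∈xs) with x ∈ₛ? (F ∪ ⁅ i ⁆) | x ∈ₛ? F
    ... | no  _  | no  _  = sumWeights-∪ xs! i∈xs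
    ... | yes x∈ | no  x∉ = contradiction (∪⁻ (λ i≡x → All.lookup x≢xs i∈xs (sym i≡x)) x∈) x∉
    ... | no  x∉ | yes x∈ = contradiction (p⊆p∪q ⁅ i ⁆ x∈) x∉
    ... | yes _  | yes _  = begin
      weight (S x) W.+ sumWeights (filter (_∈ₛ? (F ∪ ⁅ i ⁆)) xs)
        ≡⟨ cong (weight (S x) W.+_) (sumWeights-∪ xs! i∈xs) ⟩
      weight (S x) W.+ (weight (S i) W.+ s) ≡⟨ assoc _ _ _ ⟨
      weight (S x) W.+ weight (S i) W.+ s   ≡⟨ cong (W._+ s) (comm _ _) ⟩
      weight (S i) W.+ weight (S x) W.+ s   ≡⟨ assoc _ _ _ ⟩
      weight (S i) W.+ (weight (S x) W.+ s) ∎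
      where
      open ≡-Reasoning
      s = sumWeights (filter (_∈ₛ? F) xs)

    totalWeight-∪ : totalWeight S (F ∪ ⁅ i ⁆) ≡ weight (S i) W.+ totalWeight S F
    totalWeight-∪ = sumWeights-∪ (allFin⁺ n) (∈-allFin i)

  end≤start⇒∉ : ∀ {F i} → (∀ j → j ∈ₛ F → end (S j) T.≤ start (S i)) → i ∉ₛ F
  end≤start⇒∉ {i = i} before i∈F = Tₚ.<⇒≱ (start<end (S i)) (before i i∈F)

  -- The bound on end times is what lets any activity starting at or after `end (S i)` join the set.
  DPSet : Fin n → Set
  DPSet i = Σ[ F ∈ Subset n ]
    Feasible S F × (∀ j → j ∈ₛ F → end (S j) T.≤ end (S i)) × totalWeight S F ≡ dp i

  dpSet : ∀ k i → toℕ i < k → DPSet i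
  dpSet (suc k) i (s≤s i≤k) = extend before
    where
    Before : Set
    Before = Σ[ F ∈ Subset n ]
      Feasible S F × (∀ j → j ∈ₛ F → end (S j) T.≤ start (S i)) ×
      totalWeight S F ≡ W.max W.0# (map dp (predecessors i))
    before : Before
    -- `W.max` is `argmax id`, so the selection lemma applies: the maximum is the default 0,
    -- realised by the empty set, or the value of a predecessor, realised by that predecessor's set.
    before with Wₚ.argmax-sel id W.0# (map dp (predecessors i))
    ... | inj₁ max≡0 = ∅ , ∅-feasible , (λ j j∈ → contradiction j∈ ∉⊥) ,
                       trans totalWeight-∅ (sym max≡0)
    ... | inj₂ max∈ with j , j∈ , max≡ ← ∈-map⁻ dp max∈
                    with F , feas , below , tw ← dpSet k j
                           (ℕₚ.<-≤-trans (end≤start⇒< {i} {j} (predecessor⇒end≤start {i} j∈)) i≤k)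
      = F , feas , (λ l l∈ → Tₚ.≤-trans (below l l∈) (predecessor⇒end≤start {i} j∈)) ,
        trans tw (sym max≡)
    extend : Before → DPSet i
    extend (F , feas , below , tw) =
      F ∪ ⁅ i ⁆ , ∪-feasible feas (λ j j∈ → inj₁ (below j j∈)) , below′ ,
      trans (totalWeight-∪ {F} {i} (end≤start⇒∉ below))
            (trans (cong (weight (S i) W.+_) tw) (sym (dp-isDP i)))
      where
      below′ : ∀ j → j ∈ₛ F ∪ ⁅ i ⁆ → end (S j) T.≤ end (S i)
      below′ j j∈ with x∈p∪q⁻ F ⁅ i ⁆ j∈
      ... | inj₁ j∈F = Tₚ.≤-trans (below j j∈F) (start≤end i)
      ... | inj₂ j∈i = subst (λ l → end (S l) T.≤ end (S i)) (sym (x∈⁅y⁆⇒x≡y i j∈i)) Tₚ.≤-refl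

  maxDP : W.Carrier
  maxDP = W.max W.0# (List.tabulate dp)

  dp≤maxDP : ∀ i → dp i W.≤ maxDP
  dp≤maxDP i = All.lookup (Wₚ.xs≤max W.0# (List.tabulate dp)) (∈-tabulate⁺ {f = dp} i)

  weight≤dp : ∀ i → weight (S i) W.≤ dp i
  weight≤dp i = subst₂ W._≤_ (identityʳ _) (sym (dp-isDP i))
    (W.+-mono-≤ Wₚ.≤-refl (Wₚ.⊥≤max W.0# (map dp (predecessors i))))

  weight+dp≤dp : ∀ {i j} → end (S j) T.≤ start (S i) → weight (S i) W.+ dp j W.≤ dp i
  weight+dp≤dp {i} {j} ej≤si = subst (weight (S i) W.+ dp j W.≤_) (sym (dp-isDP i))
    (W.+-mono-≤ Wₚ.≤-refl (All.lookup (Wₚ.xs≤max W.0# (map dp (predecessors i)))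
                                    (∈-map⁺ dp (end≤start⇒predecessor {i} {j} ej≤si))))

  _precedes_ : Fin n → Fin n → Set
  j precedes i = end (S j) T.≤ start (S i)

  -- dp x bounds the weight of every chain ending in x, which lets it absorb the
  -- chain from the front.
  chain-bound : ∀ {x xs} → AllPairs _precedes_ (x ∷ xs) → dp x W.+ sumWeights xs W.≤ maxDP
  chain-bound {x} {[]}     _ = subst (W._≤ maxDP) (sym (identityʳ _)) (dp≤maxDP x)
  chain-bound {x} {y ∷ ys} ((x≺y ∷ _) ∷ ys!) =
    subst (W._≤ maxDP) (trans (cong (W._+ sumWeights ys) (comm _ _)) (assoc _ _ _))
          (Wₚ.≤-trans (W.+-mono-≤ (weight+dp≤dp {y} {x} x≺y) Wₚ.≤-refl) (chain-bound ys!))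

  sumWeights≤maxDP : ∀ {xs} → AllPairs _precedes_ xs → sumWeights xs W.≤ maxDP
  sumWeights≤maxDP {[]}     _   = Wₚ.⊥≤max W.0# (List.tabulate dp)
  sumWeights≤maxDP {x ∷ xs} xs! = Wₚ.≤-trans (W.+-mono-≤ (weight≤dp x) Wₚ.≤-refl) (chain-bound xs!)

  -- Of the two ways not to overlap, the one where the later index ends first is impossible: its end
  -- is at least `end (S x)`, which exceeds `start (S x)`.
  feasible⇒chain : ∀ {F} → Feasible S F → ∀ {xs} → All (_∈ₛ F) xs →
                   AllPairs Fin._<_ xs → AllPairs _precedes_ xs
  feasible⇒chain feas [] [] = []
  feasible⇒chain {F} feas {x ∷ xs} (x∈ ∷ xs∈) (x< ∷ xs!) =
    All.tabulate (λ y∈ → precedes (All.lookup xs∈ y∈) (All.lookup x< y∈)) ∷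
    feasible⇒chain feas xs∈ xs!
    where
    precedes : ∀ {y} → y ∈ₛ F → x Fin.< y → x precedes y
    precedes {y} y∈ x<y with feas x y x∈ y∈ (λ x≡y → ℕₚ.<⇒≢ x<y (cong toℕ x≡y))
    ... | inj₂ ex≤sy = ex≤sy
    ... | inj₁ ey≤sx = contradiction (Tₚ.≤-trans (sortedS x y (ℕₚ.<⇒≤ x<y)) ey≤sx)
                                     (Tₚ.<⇒≱ (start<end (S x)))

  -- For the upper bound, `totalWeight` sums along `allFin`, hence in index order, in which a
  -- feasible set is a chain. If no DP value exceeds 0, the empty set attains the maximum.
  maxDP-isMaximum : IsMaxFeasibleWeight S maxDP
  maxDP-isMaximum = attained , λ { v (F , feas , tw) → subst (W._≤ maxDP) tw
      (sumWeights≤maxDP (feasible⇒chain feas (Allₚ.all-filter (_∈ₛ? F) (allFin n))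
        (AllPairsₚ.filter⁺ (_∈ₛ? F) (AllPairsₚ.tabulate⁺-< id)))) }
    where
    attained : Σ[ F ∈ Subset n ] Feasible S F × totalWeight S F ≡ maxDP
    attained with Wₚ.argmax-sel id W.0# (List.tabulate dp)
    ... | inj₁ max≡0 = ∅ , ∅-feasible , trans totalWeight-∅ (sym max≡0)
    ... | inj₂ max∈ with i , max≡ ← ∈-tabulate⁻ max∈
                    with F , feas , _ , tw ← dpSet n i (Finₚ.toℕ<n i)
      = F , feas , trans tw (sym max≡)

-- Key order, the DP table and the loop invariant.

<ₖ-asym : ∀ {T n} → Asymmetric (_<ₖ_ T {n})
<ₖ-asym {T} (inj₁ s<t)        (inj₁ t<s)        = LinearOrderProperties.<⇒≱ T s<t (proj₁ t<s)
<ₖ-asym     (inj₁ s<t)        (inj₂ (refl , _)) = proj₂ s<t refl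
<ₖ-asym     (inj₂ (refl , _)) (inj₁ t<s)        = proj₂ t<s refl
<ₖ-asym     (inj₂ (_ , i<j))  (inj₂ (_ , j<i))  = ℕₚ.<-asym i<j j<i

module Analysis {T : LinearOrder} {W : OrderedWeights}
                (timeTrees : TimeTrees T) (dpTrees : DPTrees T W)
                {n : ℕ} (S : Vector (Activity T W) n) (sortedS : SortedByEnd S) where
  open ActivityProperties S sortedS
  open DecMembership (Finₚ._≟_ {n}) using (_∈?_)
  open Type1 timeTrees dpTrees S
  open Activity
  open Equivalence using (to; from)
  module TT = AugmentedTrees timeTrees
  module DT = AugmentedTrees dpTrees

  -- The 5 counts the tree operations on the critical path of a round: minimum query, split,
  -- flatten, range query, batch update. The 9 covers the two parallel maps of the initialisation,
  -- at most `4 * n` and `5 * n` instructions.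
  treeCost logFactor costFactor : ℕ
  treeCost   = TT.c + DT.c
  logFactor  = 1+log₂ n
  costFactor = 5 * treeCost + 9

  timeEntryOf : Fin n → TT.Entry n
  timeEntryOf = value ∘ timeEntry

  endKey : Fin n → Key T n
  endKey i = end (S i) , i

  -- The DP value stored for i while the activities in is are unprocessed.
  dpValue : List (Fin n) → Fin n → Maybe W.Carrier
  dpValue is i = if does (i ∈? is) then nothing else just (dp i)

  dpValue-∈ : ∀ {is i} → i ∈ is → dpValue is i ≡ nothing
  dpValue-∈ {is} {i} i∈ rewrite dec-true (i ∈? is) i∈ = refl

  dpValue-∉ : ∀ {is i} → i ∉ is → dpValue is i ≡ just (dp i)
  dpValue-∉ {is} {i} i∉ rewrite dec-false (i ∈? is) i∉ = refl

  tableEntry : (Fin n → Maybe W.Carrier) → Fin n → DT.Entry n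
  tableEntry v i = endKey i , v i

  dpTable : List (Fin n) → List (DT.Entry n)
  dpTable is = map (tableEntry (dpValue is)) (allFin n)

  -- Sortedness orders distinct end times, and equal ones fall to the tie-break. Index order is
  -- therefore key order, which puts the output in index order too.
  endKeys-sorted : ∀ {i j} → i Fin.< j → _<ₖ_ T (endKey i) (endKey j)
  endKeys-sorted {i} {j} i<j with end (S i) T.≟ end (S j)
  ... | yes eq  = inj₂ (eq , i<j)
  ... | no  neq = inj₁ (sortedS i j (ℕₚ.<⇒≤ i<j) , neq)

  table-sorted : (v : Fin n → Maybe W.Carrier) →
                 DT.SortedByKey (map (tableEntry v) (allFin n))
  table-sorted v = AllPairsₚ.map⁺ (AllPairsₚ.tabulate⁺-< endKeys-sorted)

  table-length : (v : Fin n → Maybe W.Carrier) →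
                 length (map (tableEntry v) (allFin n)) ≡ n
  table-length v = trans (length-map (tableEntry v) (allFin n)) (length-tabulate id)

  -- Both sides are the maximum of 0 and the members of `vs`, computed with different defaults;
  -- antisymmetry identifies them.
  max₀-max : ∀ vs → max₀ (foldr (lift W._⊔_) nothing (map just vs)) ≡ W.max W.0# vs
  max₀-max vs with foldr (lift W._⊔_) nothing (map just vs) | Wₚ.⊔-maximum vs
  ... | nothing | refl      = refl
  ... | just m  | m∈ , m≥ = Wₚ.≤-antisym
    (Wₚ.⊔-lub (Wₚ.⊥≤max W.0# vs) (All.lookup (Wₚ.xs≤max W.0# vs) m∈))
    (Wₚ.max≤v⁺ {xs = vs} (Wₚ.x≤x⊔y W.0# m)
      (All.map (λ v≤m → Wₚ.≤-trans v≤m (Wₚ.x≤y⊔x W.0# m)) m≥))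

  -- The loop invariant. `is` lists the unprocessed indices in the order of the time tree, by start
  -- time.
  record Pending (is : List (Fin n)) (st : State) : Set where
    field
      time-entries : TT.entries (proj₁ st) ≡ map timeEntryOf is
      dp-entries   : DT.entries (proj₂ st) ≡ dpTable is

    -- An index determines its key, and the keys in a tree increase strictly.
    indices-unique : Unique is
    indices-unique = AllPairs.map (λ { lt refl → <ₖ-asym {T} lt lt })
      (AllPairsₚ.map⁻ (subst TT.SortedByKey time-entries (TT.sorted (proj₁ st))))

    time-size : TT.size (proj₁ st) ≡ length is
    time-size = trans (cong length time-entries) (length-map timeEntryOf is)

    time-log : 1+log₂ (TT.size (proj₁ st)) ≤ logFactor
    time-log = s≤s (⌈log₂⌉-mono-≤ (subst (_≤ n) (sym time-size) (unique⇒length≤ indices-unique)))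

    dp-log : 1+log₂ (DT.size (proj₂ st)) ≡ logFactor
    dp-log = cong 1+log₂ (trans (cong length dp-entries) (table-length (dpValue is)))

  time-cost : ∀ {x y} → x ≤ y → TT.c * x ≤ treeCost * y
  time-cost = ℕₚ.*-mono-≤ (ℕₚ.m≤m+n TT.c DT.c)

  dp-cost : ∀ {x y} → x ≤ y → DT.c * x ≤ treeCost * y
  dp-cost = ℕₚ.*-mono-≤ (ℕₚ.m≤n+m DT.c TT.c)

  span≤work : {A : Set} (r : Run A) → span r ≤ work r
  span≤work r = traceSpan≤traceWork (trace r)

  earliestEnd : State → Maybe T.Carrier
  earliestEnd (ttime , _) = value (TT.query everything ttime)

  earliestEnd-isMinimum : ∀ {is st} → Pending is st →
                          IsExtremum T._≤_ (map (end ∘ S) is) (earliestEnd st)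
  earliestEnd-isMinimum {is} {st} p =
    subst (IsExtremum T._≤_ (map (end ∘ S) is)) (sym query-value)
          (Tₚ.⊓-minimum (map (end ∘ S) is))
    where
    open Pending p
    open ≡-Reasoning
    query-value : earliestEnd st ≡ foldr (lift T._⊓_) nothing (map just (map (end ∘ S) is))
    query-value = begin
      earliestEnd st
        ≡⟨ TT.query-value everything (proj₁ st) ⟩
      foldr (lift T._⊓_) nothing
        (map proj₂ (filter (inRange? T everything ∘ TT.time) (TT.entries (proj₁ st))))
        ≡⟨ cong (foldr (lift T._⊓_) nothing ∘ map proj₂)
             (trans (filter-all (inRange? T everything ∘ TT.time) (All.universal (λ _ → tt) _))
                    time-entries) ⟩
      foldr (lift T._⊓_) nothing (map proj₂ (map timeEntryOf is))
        ≡⟨ cong (foldr (lift T._⊓_) nothing) (trans (sym (map-∘ is)) (map-∘ is)) ⟩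
      foldr (lift T._⊓_) nothing (map just (map (end ∘ S) is)) ∎

  -- A single round: correctness and cost.

  -- The summands are split, flatten, parallel map and update, in this order. The 7 is the 2 per
  -- element of a parallel map plus the 5 plain instructions of `computeDP`.
  frontierWork : ℕ → ℕ
  frontierWork m = treeCost * logFactor + (treeCost * suc m +
    ((7 + treeCost * logFactor) * m + treeCost * (suc m * logFactor)))

  frontierSpan : ℕ
  frontierSpan = treeCost * logFactor + (treeCost * logFactor +
    (2 * logFactor + (5 + treeCost * logFactor) + treeCost * logFactor))

  -- The number of activities processed is `suc processed`: that it is positive makes the loop end
  -- and lets the fixed cost of a round be charged to an activity.
  record Progress (is : List (Fin n)) (r : Run (State ⊎ DT.Tree n)) : Set where
    field
      next        : State
      remaining   : List (Fin n)
      processed   : ℕ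
      first       : Fin n
      continues   : value r ≡ inj₁ next
      pending     : Pending remaining next
      size        : suc processed + length remaining ≡ length is
      first∈      : first ∈ is
      remaining⊆  : ∀ {j} → j ∈ remaining → j ∈ is
      first≤      : ∀ {j} → j ∈ remaining → end (S first) T.≤ start (S j)
      work≤       : work r ≤ frontierWork (suc processed)
      span≤       : span r ≤ frontierSpan

  module Round {is : List (Fin n)} {ttime : TT.Tree n} {tdp : DT.Tree n}
               (pending : Pending is (ttime , tdp))
               {first : Fin n} (first∈ : first ∈ is)
               (first-min : ∀ {i} → i ∈ is → end (S first) T.≤ end (S i)) where
    open Pending pending

    e* : T.Carrier
    e* = end (S first)

    early? = λ i → start (S i) T.<? e*

    frontier remaining : List (Fin n)
    frontier  = filter early? is
    remaining = filter (¬? ∘ early?) is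

    frontierTree remainingTree : TT.Tree n
    frontierTree  = proj₁ (value (TT.split e* ttime))
    remainingTree = proj₂ (value (TT.split e* ttime))

    frontier-entries : TT.entries frontierTree ≡ map timeEntryOf frontier
    frontier-entries = trans (TT.split-entries₁ e* ttime)
      (trans (cong (filter (λ e → TT.time e T.<? e*)) time-entries) (filter-map _ timeEntryOf is))

    remaining-entries : TT.entries remainingTree ≡ map timeEntryOf remaining
    remaining-entries = trans (TT.split-entries₂ e* ttime)
      (trans (cong (filter (λ e → ¬? (TT.time e T.<? e*))) time-entries)
             (filter-map _ timeEntryOf is))

    -- An activity starts before its own end, so no frontier is empty.
    first∈frontier : first ∈ frontier
    first∈frontier = ∈-filter⁺ early? first∈ (start<end (S first))

    predecessor∉ : ∀ {i j} → i ∈ frontier → j ∈ predecessors i → j ∉ is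
    predecessor∉ {i} {j} i∈ j∈ j∈is = Tₚ.<⇒≱ (proj₂ (∈-filter⁻ early? {xs = is} i∈))
      (Tₚ.≤-trans (first-min j∈is) (predecessor⇒end≤start {i} j∈))

    computedEntry : Fin n → DT.Entry n
    computedEntry i = endKey i , just (dp i)

    computeDP-value : ∀ {i} → i ∈ frontier →
                      value (computeDP tdp (timeEntryOf i)) ≡ computedEntry i
    computeDP-value {i} i∈ = cong (λ v → endKey i , just v)
      (trans (cong (weight (S i) W.+_) max≡) (sym (dp-isDP i)))
      where
      open ≡-Reasoning
      range? = inRange? T (upTo (start (S i)))
      max≡ : max₀ (value (DT.query (upTo (start (S i))) tdp)) ≡ W.max W.0# (map dp (predecessors i))
      max≡ = begin
        max₀ (value (DT.query (upTo (start (S i))) tdp))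
          ≡⟨ cong max₀ (DT.query-value (upTo (start (S i))) tdp) ⟩
        max₀ (foldr (lift W._⊔_) nothing (map proj₂ (filter (range? ∘ DT.time) (DT.entries tdp))))
          -- Composed with `tableEntry`, the range test on keys unfolds to the test that defines
          -- `predecessors`.
          ≡⟨ cong (max₀ ∘ foldr (lift W._⊔_) nothing ∘ map proj₂)
               (trans (cong (filter (range? ∘ DT.time)) dp-entries)
                      (filter-map (range? ∘ DT.time) _ (allFin n))) ⟩
        max₀ (foldr (lift W._⊔_) nothing
          (map proj₂ (map (tableEntry (dpValue is)) (predecessors i))))
          ≡⟨ cong (max₀ ∘ foldr (lift W._⊔_) nothing) (begin
               map proj₂ (map (tableEntry (dpValue is)) (predecessors i))
                 ≡⟨ map-∘ (predecessors i) ⟨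
               map (dpValue is) (predecessors i)
                 ≡⟨ map-cong-local (All.tabulate λ j∈ → dpValue-∉ (predecessor∉ {i} i∈ j∈)) ⟩
               map (just ∘ dp) (predecessors i)
                 ≡⟨ map-∘ (predecessors i) ⟩
               map just (map dp (predecessors i)) ∎) ⟩
        max₀ (foldr (lift W._⊔_) nothing (map just (map dp (predecessors i))))
          ≡⟨ max₀-max (map dp (predecessors i)) ⟩
        W.max W.0# (map dp (predecessors i)) ∎

    es : List (TT.Entry n)
    es = value (TT.flatten frontierTree)

    es≡ : es ≡ map timeEntryOf frontier
    es≡ = trans (TT.flatten-value frontierTree) frontier-entries

    us : List (DT.Entry n)
    us = value (parMap (computeDP tdp) es)

    us≡ : us ≡ map computedEntry frontier
    us≡ = begin
      us ≡⟨ parMap-value (computeDP tdp) es ⟩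
      map (value ∘ computeDP tdp) es ≡⟨ cong (map _) es≡ ⟩
      map (value ∘ computeDP tdp) (map timeEntryOf frontier) ≡⟨ map-∘ frontier ⟨
      map (value ∘ computeDP tdp ∘ timeEntryOf) frontier
        ≡⟨ map-cong-local (All.tabulate computeDP-value) ⟩
      map computedEntry frontier ∎
      where open ≡-Reasoning

    us-keys : map proj₁ us ≡ map endKey frontier
    us-keys = trans (cong (map proj₁) us≡) (sym (map-∘ frontier))

    us-unique : Unique (map proj₁ us)
    us-unique = subst Unique (sym us-keys)
      (map⁺ (cong proj₂) (filter⁺ early? indices-unique))

    tdp′ : DT.Tree n
    tdp′ = value (DT.update us tdp)

    early⇒dpValue : ∀ {i} → i ∈ frontier → dpValue remaining i ≡ just (dp i)
    early⇒dpValue i∈ = dpValue-∉ λ i∈r →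
      proj₂ (∈-filter⁻ (¬? ∘ early?) {xs = is} i∈r) (proj₂ (∈-filter⁻ early? {xs = is} i∈))

    late⇒dpValue : ∀ {i} → i ∉ frontier → dpValue remaining i ≡ dpValue is i
    late⇒dpValue {i} i∉ with i ∈? is
    ... | yes i∈is = dpValue-∈ (∈-filter⁺ (¬? ∘ early?) i∈is (i∉ ∘ ∈-filter⁺ early? i∈is))
    ... | no  i∉is = dpValue-∉ (i∉is ∘ proj₁ ∘ ∈-filter⁻ (¬? ∘ early?) {xs = is})

    -- Since `update-entries` gives members only, equality comes from `sorted-unique`. An index in
    -- the frontier has its entry overwritten; any other keeps the value it had.
    tdp′-entries : DT.entries tdp′ ≡ dpTable remaining
    tdp′-entries = sorted-unique (<ₖ-asym {T}) (DT.sorted tdp′) (table-sorted (dpValue remaining))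
      (λ {e} e∈ → ⊆ (to (DT.update-entries us tdp us-unique e) e∈))
      (λ {e} e∈ → from (DT.update-entries us tdp us-unique e) (⊇ e∈))
      where
      ⊆ : ∀ {e} → e ∈ us ⊎ (e ∈ DT.entries tdp × proj₁ e ∉ map proj₁ us) → e ∈ dpTable remaining
      ⊆ (inj₁ e∈us) with i , i∈ , refl ← ∈-map⁻ computedEntry (subst (_ ∈_) us≡ e∈us) =
        subst (λ v → (endKey i , v) ∈ dpTable remaining) (early⇒dpValue i∈)
              (∈-map⁺ (tableEntry (dpValue remaining)) (∈-allFin i))
      ⊆ (inj₂ (e∈ , e∉)) with i , _ , refl ← ∈-map⁻ _ (subst (_ ∈_) dp-entries e∈) =
        subst (λ v → (endKey i , v) ∈ dpTable remaining)
              (late⇒dpValue (λ i∈ → e∉ (subst (endKey i ∈_) (sym us-keys) (∈-map⁺ endKey i∈))))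
              (∈-map⁺ (tableEntry (dpValue remaining)) (∈-allFin i))
      ⊇ : ∀ {e} → e ∈ dpTable remaining → e ∈ us ⊎ (e ∈ DT.entries tdp × proj₁ e ∉ map proj₁ us)
      ⊇ e∈ with i , _ , refl ← ∈-map⁻ _ e∈ with i ∈? frontier
      ... | yes i∈ = inj₁ (subst₂ (λ v vs → (endKey i , v) ∈ vs) (sym (early⇒dpValue i∈)) (sym us≡)
                                  (∈-map⁺ computedEntry i∈))
      ... | no  i∉ = inj₂
        ( subst₂ (λ v vs → (endKey i , v) ∈ vs) (sym (late⇒dpValue i∉)) (sym dp-entries)
                 (∈-map⁺ (tableEntry (dpValue is)) (∈-allFin i))
        , λ k∈ → i∉ (frontier-key (subst (endKey i ∈_) us-keys k∈)))
        where
        frontier-key : ∀ {i} → endKey i ∈ map endKey frontier → i ∈ frontier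
        frontier-key k∈ with j , j∈ , refl ← ∈-map⁻ endKey k∈ = j∈

    pending′ : Pending remaining (remainingTree , tdp′)
    pending′ = record { time-entries = remaining-entries ; dp-entries = tdp′-entries }

    open Pending pending′ using () renaming (dp-log to dp-log′)

    round-run : Run (State ⊎ DT.Tree n)
    round-run = processFrontier (ttime , tdp) (just e*)

    es-length : length es ≡ length frontier
    es-length = trans (cong length es≡) (length-map timeEntryOf frontier)

    frontier-size : TT.size frontierTree ≡ length frontier
    frontier-size = trans (cong length frontier-entries) (length-map timeEntryOf frontier)

    us-length : length us ≡ length frontier
    us-length = trans (cong length us≡) (length-map computedEntry frontier)

    log-frontier : 1+log₂ (length frontier) ≤ logFactor
    log-frontier = s≤s (⌈log₂⌉-mono-≤ (unique⇒length≤ (filter⁺ early? indices-unique)))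

    split-work : work (TT.split e* ttime) ≤ treeCost * logFactor
    split-work = ℕₚ.≤-trans (TT.split-work e* ttime) (time-cost time-log)

    computeDP-work : ∀ e → work (computeDP tdp e) ≤ 5 + treeCost * logFactor
    computeDP-work ((s , i) , _) = subst (_≤ 5 + treeCost * logFactor) (ℕₚ.+-comm 5 _)
      (ℕₚ.+-monoʳ-≤ 5 (ℕₚ.≤-trans (DT.query-work (upTo s) tdp) (dp-cost (ℕₚ.≤-reflexive dp-log))))

    round-work : work round-run ≤ frontierWork (length frontier)
    round-work =
      ℕₚ.+-mono-≤ split-work
      (ℕₚ.+-mono-≤ (ℕₚ.≤-trans (TT.flatten-work frontierTree)
                               (time-cost (ℕₚ.≤-reflexive (cong suc frontier-size))))
      (ℕₚ.+-mono-≤ (ℕₚ.≤-trans (parMap-work (computeDP tdp) _ computeDP-work es)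
                               (ℕₚ.≤-reflexive (cong ((7 + treeCost * logFactor) *_) es-length)))
      -- The closing `return` leaves a summand 0.
      (ℕₚ.≤-trans (ℕₚ.≤-reflexive (ℕₚ.+-identityʳ _))
      (ℕₚ.≤-trans (DT.update-work us tdp us-unique)
                  (dp-cost (ℕₚ.*-mono-≤ (ℕₚ.≤-reflexive (cong suc us-length))
                                        (ℕₚ.≤-reflexive dp-log′)))))))

    round-span : span round-run ≤ frontierSpan
    round-span =
      ℕₚ.+-mono-≤ (ℕₚ.≤-trans (span≤work (TT.split e* ttime)) split-work)
      (ℕₚ.+-mono-≤ (ℕₚ.≤-trans (TT.flatten-span frontierTree)
                               (time-cost (subst (λ k → 1+log₂ k ≤ logFactor)
                                                 (sym frontier-size) log-frontier)))
      (ℕₚ.+-mono-≤ (ℕₚ.≤-trans (parMap-span (computeDP tdp) _ computeDP-work es)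
                               (ℕₚ.+-monoˡ-≤ _ (ℕₚ.*-monoʳ-≤ 2
                                 (subst (λ k → ⌈log₂ k ⌉ ≤ logFactor) (sym es-length)
                                        (ℕₚ.≤-trans (ℕₚ.n≤1+n _) log-frontier)))))
      (ℕₚ.≤-trans (ℕₚ.≤-reflexive (ℕₚ.+-identityʳ _))
      (ℕₚ.≤-trans (DT.update-span us tdp us-unique)
                  (dp-cost (ℕₚ.≤-reflexive dp-log′))))))

    progress : Progress is round-run
    -- Membership of `first` excludes the empty frontier and exposes the successor that `Progress`
    -- asks for.
    progress with frontier in eq | first∈frontier
    ... | i ∷ fs | _ = record
      { next       = remainingTree , tdp′
      ; remaining  = remaining
      ; processed  = length fs
      ; first      = first
      ; continues  = refl
      ; pending    = pending′
      ; size       = trans (cong (λ xs → length xs + length remaining) (sym eq))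
                           (length-filter-∁ early? is)
      ; first∈     = first∈
      ; remaining⊆ = proj₁ ∘ ∈-filter⁻ (¬? ∘ early?) {xs = is}
      ; first≤     = Tₚ.≮⇒≥ ∘ proj₂ ∘ ∈-filter⁻ (¬? ∘ early?) {xs = is}
      ; work≤      = subst (λ xs → work round-run ≤ frontierWork (length xs)) eq round-work
      ; span≤      = round-span
      }

  -- F holds the earliest-end activity of each round, so ∣ F ∣ counts the rounds.
  Completes : List (Fin n) → State → Set
  Completes is st = Σ[ r ∈ Run (DT.Tree n) ] Σ[ F ∈ Subset n ]
    Loop round st r × DT.entries (value r) ≡ dpTable [] ×
    Feasible S F × (∀ {j} → j ∈ₛ F → j ∈ is) ×
    work r ≤ costFactor * ((1 + 2 * length is) * logFactor) ×
    span r ≤ costFactor * ((1 + ∣ F ∣) * logFactor)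

  -- Existence and cost of the whole loop.

  query-work : ∀ {is st} → Pending is st →
               work (TT.query everything (proj₁ st)) ≤ treeCost * logFactor
  query-work {st = st} p =
    ℕₚ.≤-trans (TT.query-work everything (proj₁ st)) (time-cost (Pending.time-log p))

  module _ {is : List (Fin n)} {st : State} (pending : Pending is st)
           (recurse : ∀ {is′ st′} → length is′ < length is → Pending is′ st′ → Completes is′ st′) where

    -- The last round is one query and one instruction. It selects no activity, and is the 1 in both
    -- bounds of `Completes`.
    complete-exit : earliestEnd st ≡ nothing → is ≡ [] → Completes is st
    complete-exit eq refl =
      run (proj₂ st) (trace (round st)) , ∅ ,
      exit (cong (λ m → value (processFrontier st m)) eq) ,
      Pending.dp-entries pending , ∅-feasible , (λ j∈ → contradiction j∈ ∉⊥) ,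
      bound , ℕₚ.≤-trans (span≤work (round st)) (ℕₚ.≤-trans bound
        (ℕₚ.*-monoʳ-≤ costFactor (ℕₚ.*-monoˡ-≤ logFactor (ℕₚ.m≤m+n 1 ∣ ∅ {n} ∣))))
      where
      arith : ∀ a l → (5 * a + 9) * (1 * suc l) ≡
              a * suc l + 1 + (4 * a * suc l + 8 + 9 * l)
      arith = solve-∀
      bound : work (round st) ≤ costFactor * (1 * logFactor)
      bound = ℕₚ.≤-trans
        (ℕₚ.+-mono-≤ (query-work pending)
          (ℕₚ.≤-reflexive (cong (λ m → 1 + work (processFrontier st m)) eq)))
        (≡+⇒≤ (4 * treeCost * logFactor + 8 + 9 * ⌈log₂ n ⌉) (arith treeCost ⌈log₂ n ⌉))

    complete-again : ∀ {e*} → earliestEnd st ≡ just e* →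
                     Progress is (processFrontier st (just e*)) → Completes is st
    complete-again {e*} eq progress
      with r , F , loop , entries≡ , feasible , F⊆ , loop-work , loop-span
             ← recurse (subst (length (Progress.remaining progress) <_) (Progress.size progress)
                              (s≤s (ℕₚ.m≤n+m _ (Progress.processed progress))))
                       (Progress.pending progress) =
      run (value r) (trace (round st) ⨾ trace r) , F ∪ ⁅ first ⁆ ,
      again (trans (cong (λ m → value (processFrontier st m)) eq) continues) loop ,
      entries≡ ,
      ∪-feasible feasible (λ j j∈ → inj₂ (first≤ (F⊆ j∈))) ,
      F∪⊆ ,
      total-work , total-span
      where
      open Progress progress hiding (pending)

      work-arith : ∀ a l m → (5 * a + 9) * ((2 + m) * suc l) ≡
        a * suc l + (1 + (a * suc l + (a * (2 + m) +
          ((7 + a * suc l) * suc m + a * ((2 + m) * suc l))))) +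
        (a * (3 + 2 * m) + l * a * (5 + 3 * m) + 8 + m +
          8 * l * (2 + m) + (2 + m) * suc l)
      work-arith = solve-∀

      span-arith : ∀ a l → (5 * a + 9) * suc l ≡
        a * suc l + (1 + (a * suc l + (a * suc l +
          (2 * suc l + (5 + a * suc l) + a * suc l)))) + (1 + 7 * l)
      span-arith = solve-∀

      first-round-work : work (round st) ≤ costFactor * ((2 + processed) * logFactor)
      first-round-work = ℕₚ.≤-trans
        (ℕₚ.+-mono-≤ (query-work pending)
          (s≤s (subst (λ e → work (processFrontier st e) ≤ frontierWork (suc processed))
                      (sym eq) work≤)))
        (≡+⇒≤ _ (work-arith treeCost ⌈log₂ n ⌉ processed))

      first-round-span : span (round st) ≤ costFactor * logFactor
      first-round-span = ℕₚ.≤-trans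
        (ℕₚ.+-mono-≤ (ℕₚ.≤-trans (span≤work (TT.query everything (proj₁ st))) (query-work pending))
          (s≤s (subst (λ e → span (processFrontier st e) ≤ frontierSpan) (sym eq) span≤)))
        (≡+⇒≤ _ (span-arith treeCost ⌈log₂ n ⌉))

      -- A round on `suc m` activities is charged `2 + m`: one per activity and one for the round
      -- itself. The latter is paid by an activity of the round, whence the factor 2 and the slack
      -- `m`.
      sum-arith : ∀ k m r l → k * ((1 + 2 * (suc m + r)) * l) ≡
        k * ((2 + m) * l) + k * ((1 + 2 * r) * l) + k * (m * l)
      sum-arith = solve-∀

      total-work : work (round st) + work r ≤ costFactor * ((1 + 2 * length is) * logFactor)
      total-work = ℕₚ.≤-trans (ℕₚ.+-mono-≤ first-round-work loop-work)
        (ℕₚ.≤-trans (≡+⇒≤ _ (sum-arith costFactor processed (length remaining) logFactor))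
          (ℕₚ.≤-reflexive (cong (λ k → costFactor * ((1 + 2 * k) * logFactor)) size)))

      first∉F : first ∉ₛ F
      first∉F first∈F = Tₚ.<⇒≱ (start<end (S first)) (first≤ (F⊆ first∈F))

      F∪⊆ : ∀ {j} → j ∈ₛ F ∪ ⁅ first ⁆ → j ∈ is
      F∪⊆ j∈ with x∈p∪q⁻ F ⁅ first ⁆ j∈
      ... | inj₁ j∈F = remaining⊆ (F⊆ j∈F)
      ... | inj₂ j∈i = subst (_∈ is) (sym (x∈⁅y⁆⇒x≡y first j∈i)) first∈

      -- The new member of the set pays for the span of this round.
      total-span : span (round st) + span r ≤ costFactor * ((1 + ∣ F ∪ ⁅ first ⁆ ∣) * logFactor)
      total-span = ℕₚ.≤-trans (ℕₚ.+-mono-≤ first-round-span loop-span)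
        (ℕₚ.≤-trans (ℕₚ.≤-reflexive (sym (ℕₚ.*-distribˡ-+ costFactor logFactor _)))
          (ℕₚ.*-monoʳ-≤ costFactor (ℕₚ.*-monoˡ-≤ logFactor (s≤s (∣∪∣ {F} {first} first∉F)))))

    complete-step : ∀ m → earliestEnd st ≡ m → IsExtremum T._≤_ (map (end ∘ S) is) m →
                    Completes is st
    complete-step nothing  eq none = complete-exit eq (map-[] none)
      where
      map-[] : ∀ {is} → map (end ∘ S) is ≡ [] → is ≡ []
      map-[] {[]} _ = refl
    complete-step (just e*) eq (e*∈ , e*≤) with i , i∈ , refl ← ∈-map⁻ (end ∘ S) e*∈ =
      complete-again eq
        (Round.progress pending i∈ (λ j∈ → All.lookup e*≤ (∈-map⁺ (end ∘ S) j∈)))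

  -- A round may remove any positive number of activities, so the induction is strong, with `k` as a
  -- strict bound on the number pending.
  complete : ∀ k {is st} → length is < k → Pending is st → Completes is st
  complete (suc k) {st = st} (s≤s is≤k) pending =
    complete-step pending (λ is′<is → complete k (ℕₚ.<-≤-trans is′<is is≤k)) (earliestEnd st) refl
                  (earliestEnd-isMinimum pending)

  -- Initialisation.

  dpEntries : List (DT.Entry n)
  dpEntries = value (parMap dpEntry (allFin n))

  dpEntries≡ : dpEntries ≡ map (tableEntry (λ _ → nothing)) (allFin n)
  dpEntries≡ = parMap-value dpEntry (allFin n)

  dpEntries-sorted : DT.SortedByKey dpEntries
  dpEntries-sorted = subst DT.SortedByKey (sym dpEntries≡) (table-sorted (λ _ → nothing))

  dpEntries-length : length dpEntries ≡ n
  dpEntries-length = trans (cong length dpEntries≡) (table-length (λ _ → nothing))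

  timeEntries : List (TT.Entry n)
  timeEntries = value (parMap timeEntry (allFin n))

  timeEntries≡ : timeEntries ≡ map timeEntryOf (allFin n)
  timeEntries≡ = parMap-value timeEntry (allFin n)

  timeEntries-length : length timeEntries ≡ n
  timeEntries-length = trans (cong length timeEntries≡)
    (trans (length-map timeEntryOf (allFin n)) (length-tabulate id))

  timeEntries-unique : Unique (map proj₁ timeEntries)
  timeEntries-unique = subst (Unique ∘ map proj₁) (sym timeEntries≡)
    (subst Unique (map-∘ (allFin n)) (map⁺ (cong proj₂) (allFin⁺ n)))

  emptyTree : TT.Tree n
  emptyTree = value (TT.build [])

  emptyTree-entries : TT.entries emptyTree ≡ []
  emptyTree-entries = TT.build-entries [] []

  timeTree : TT.Tree n
  timeTree = value (TT.update timeEntries emptyTree)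

  -- The insertions fix the members of the time tree, while their order depends on the start times;
  -- the indices are therefore read back from its entries.
  allIndices : List (Fin n)
  allIndices = map (proj₂ ∘ proj₁) (TT.entries timeTree)

  entry-form : ∀ {e} → e ∈ TT.entries timeTree → timeEntryOf (proj₂ (proj₁ e)) ≡ e
  entry-form {e} e∈ with to (TT.update-entries timeEntries emptyTree timeEntries-unique e) e∈
  ... | inj₂ (e∈∅ , _) with () ← subst (e ∈_) emptyTree-entries e∈∅
  ... | inj₁ e∈t with i , _ , refl ← ∈-map⁻ timeEntryOf (subst (e ∈_) timeEntries≡ e∈t) = refl

  ∈-allIndices : ∀ i → i ∈ allIndices
  ∈-allIndices i = ∈-map⁺ (proj₂ ∘ proj₁)
    (from (TT.update-entries timeEntries emptyTree timeEntries-unique (timeEntryOf i))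
          (inj₁ (subst (timeEntryOf i ∈_) (sym timeEntries≡) (∈-map⁺ timeEntryOf (∈-allFin i)))))

  initially-pending : Pending allIndices (value initialise)
  initially-pending = record
    { time-entries = sym (trans (sym (map-∘ (TT.entries timeTree)))
                                (map-id-local (All.tabulate entry-form)))
    ; dp-entries   = trans (DT.build-entries dpEntries dpEntries-sorted)
        (trans dpEntries≡ (map-cong (λ i → cong (endKey i ,_) (sym (dpValue-∈ (∈-allIndices i))))
                                    (allFin n)))
    }

  log-n : ∀ {m} → m ≡ n → 1+log₂ m ≤ logFactor
  log-n eq = ℕₚ.≤-reflexive (cong 1+log₂ eq)

  n-length : length (allFin n) ≡ n
  n-length = length-tabulate id

  initialise-work : work initialise ≤ costFactor * (suc n * logFactor)
  initialise-work = ℕₚ.≤-trans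
    (ℕₚ.+-mono-≤ (ℕₚ.≤-trans (parMap-work dpEntry 2 (λ _ → ℕₚ.≤-refl) (allFin n))
                             (ℕₚ.≤-reflexive (cong (λ k → 4 * k) n-length)))
    (ℕₚ.+-mono-≤ (ℕₚ.≤-trans (DT.build-work dpEntries dpEntries-sorted)
                             (dp-cost (s≤s (ℕₚ.≤-reflexive dpEntries-length))))
    (ℕₚ.+-mono-≤ (ℕₚ.≤-trans (parMap-work timeEntry 3 (λ _ → ℕₚ.≤-refl) (allFin n))
                             (ℕₚ.≤-reflexive (cong (λ k → 5 * k) n-length)))
    (ℕₚ.+-mono-≤ (ℕₚ.≤-trans (TT.build-work {n} [] []) (time-cost ℕₚ.≤-refl))
    (ℕₚ.≤-trans (ℕₚ.≤-reflexive (ℕₚ.+-identityʳ _))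
    (ℕₚ.≤-trans (TT.update-work timeEntries emptyTree timeEntries-unique)
      (time-cost (ℕₚ.*-mono-≤ (s≤s (ℕₚ.≤-reflexive timeEntries-length))
                              (Pending.time-log initially-pending)))))))))
    (≡+⇒≤ _ (arith treeCost ⌈log₂ n ⌉ n))
    where
    arith : ∀ a l n → (5 * a + 9) * (suc n * suc l) ≡
      4 * n + (a * suc n + (5 * n + (a * 1 + a * (suc n * suc l)))) +
      (9 + 9 * l * suc n + a * n + 2 * a * suc n * l +
       2 * a * (suc n * suc l))
    arith = solve-∀

  initialise-span : span initialise ≤ costFactor * logFactor
  initialise-span = ℕₚ.≤-trans
    (ℕₚ.+-mono-≤ (ℕₚ.≤-trans (parMap-span dpEntry 2 (λ _ → ℕₚ.≤-refl) (allFin n))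
                             (ℕₚ.≤-reflexive (cong (λ k → 2 * ⌈log₂ k ⌉ + 2) n-length)))
    (ℕₚ.+-mono-≤ (ℕₚ.≤-trans (DT.build-span dpEntries dpEntries-sorted)
                             (dp-cost (log-n dpEntries-length)))
    (ℕₚ.+-mono-≤ (ℕₚ.≤-trans (parMap-span timeEntry 3 (λ _ → ℕₚ.≤-refl) (allFin n))
                             (ℕₚ.≤-reflexive (cong (λ k → 2 * ⌈log₂ k ⌉ + 3) n-length)))
    (ℕₚ.+-mono-≤ (ℕₚ.≤-trans (TT.build-span {n} [] []) (time-cost ℕₚ.≤-refl))
    (ℕₚ.≤-trans (ℕₚ.≤-reflexive (ℕₚ.+-identityʳ _))
    (ℕₚ.≤-trans (TT.update-span timeEntries emptyTree timeEntries-unique)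
      (time-cost (Pending.time-log initially-pending))))))))
    (≡+⇒≤ _ (arith treeCost ⌈log₂ n ⌉))
    where
    arith : ∀ a l → (5 * a + 9) * suc l ≡
      2 * l + 2 + (a * suc l + (2 * l + 3 + (a * 1 + a * suc l))) +
      (4 + 5 * l + a * l + 2 * a * suc l)
    arith = solve-∀

  -- Output.

  module _ {tdp : DT.Tree n} (entries≡ : DT.entries tdp ≡ dpTable []) where

    outputEntries : List (DT.Entry n)
    outputEntries = value (DT.flatten tdp)

    outputEntries≡ : outputEntries ≡ dpTable []
    outputEntries≡ = trans (DT.flatten-value tdp) entries≡

    outputEntries-length : length outputEntries ≡ n
    outputEntries-length = trans (cong length outputEntries≡) (table-length (dpValue []))

    size≡n : DT.size tdp ≡ n
    size≡n = trans (cong length entries≡) (table-length (dpValue []))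

    output-value : value (output tdp) ≡ List.tabulate (just ∘ dp)
    output-value = begin
      value (output tdp)           ≡⟨ parMap-value (instr ∘ proj₂) outputEntries ⟩
      map proj₂ outputEntries      ≡⟨ cong (map proj₂) outputEntries≡ ⟩
      map proj₂ (dpTable [])       ≡⟨ map-∘ (allFin n) ⟨
      map (just ∘ dp) (allFin n)   ≡⟨ map-tabulate id (just ∘ dp) ⟩
      List.tabulate (just ∘ dp)    ∎
      where open ≡-Reasoning

    output-work : work (output tdp) ≤ costFactor * (suc n * logFactor)
    output-work = ℕₚ.≤-trans
      (ℕₚ.+-mono-≤ (ℕₚ.≤-trans (DT.flatten-work tdp) (dp-cost (s≤s (ℕₚ.≤-reflexive size≡n))))
                   (ℕₚ.≤-trans (parMap-work (instr ∘ proj₂) 1 (λ _ → ℕₚ.≤-refl) outputEntries)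
                             (ℕₚ.≤-reflexive (cong (λ k → 3 * k) outputEntries-length))))
      (≡+⇒≤ _ (arith treeCost ⌈log₂ n ⌉ n))
      where
      arith : ∀ a l n → (5 * a + 9) * (suc n * suc l) ≡ a * suc n + 3 * n +
        (4 * a * (suc n * suc l) + a * suc n * l +
         6 * (suc n * suc l) + 3 * suc n * l + 3)
      arith = solve-∀

    output-span : span (output tdp) ≤ costFactor * logFactor
    output-span = ℕₚ.≤-trans
      (ℕₚ.+-mono-≤ (ℕₚ.≤-trans (DT.flatten-span tdp) (dp-cost (log-n size≡n)))
                   (ℕₚ.≤-trans (parMap-span (instr ∘ proj₂) 1 (λ _ → ℕₚ.≤-refl) outputEntries)
                             (ℕₚ.≤-reflexive (cong (λ k → 2 * ⌈log₂ k ⌉ + 1) outputEntries-length))))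
      (≡+⇒≤ _ (arith treeCost ⌈log₂ n ⌉))
      where
      arith : ∀ a l → (5 * a + 9) * suc l ≡ a * suc l + (2 * l + 1) +
        (4 * a * suc l + 8 + 7 * l)
      arith = solve-∀

  -- The bounds for a complete execution.

  -- A single activity is feasible. This lets constant multiples of the logarithm be absorbed into
  -- the span bound.
  rank-positive : ∀ {rank} → 1 ≤ n → IsRank S rank → 1 ≤ rank
  rank-positive (s≤s _) (_ , maximal) = ℕₚ.≤-trans (ℕₚ.≤-trans (s≤s z≤n) (∣∪∣ {∅} {Fin.zero} ∉⊥))
    (maximal _ (_ , ∪-feasible {∅} {Fin.zero} ∅-feasible (λ j j∈ → contradiction j∈ ∉⊥) , refl))

  -- For `2 ≤ n` the logarithm is at least 1, so `logFactor` is at most twice it; with the 6 this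
  -- gives 12.
  scale : ∀ {x y} → 2 ≤ n → x ≤ 6 * y →
          costFactor * (x * logFactor) ≤ 12 * costFactor * (y * ⌈log₂ n ⌉)
  scale {x} {y} 2≤n x≤6y = ℕₚ.≤-trans
    (ℕₚ.*-monoʳ-≤ costFactor (ℕₚ.*-mono-≤ x≤6y (ℕₚ.+-monoˡ-≤ ⌈log₂ n ⌉ (⌈log₂⌉-mono-≤ 2≤n))))
    (ℕₚ.≤-reflexive (arith costFactor y ⌈log₂ n ⌉))
    where
    arith : ∀ k y l → k * (6 * y * (l + l)) ≡ 12 * k * (y * l)
    arith = solve-∀

  execution-bounds : 2 ≤ n → (rank : ℕ) → IsRank S rank →
    Σ[ r ∈ Run (List (Maybe W.Carrier)) ]
      Executes r × Solves S (value r) ×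
      work r ≤ 12 * costFactor * (n * ⌈log₂ n ⌉) ×
      span r ≤ 12 * costFactor * (rank * ⌈log₂ n ⌉)
  execution-bounds 2≤n rank isRank
    with rounds , F , loop , entries≡ , feasible , _ , loop-work , loop-span
           ← complete _ ℕₚ.≤-refl initially-pending =
    (initialise >>= λ _ → rounds >>= output) , (rounds , loop , refl) ,
    (dp , output-value entries≡ , dp-isDP , maxDP-isMaximum) ,
    ℕₚ.≤-trans (ℕₚ.+-mono-≤ initialise-work (ℕₚ.+-mono-≤
        (ℕₚ.≤-trans loop-work (ℕₚ.*-monoʳ-≤ costFactor (ℕₚ.*-monoˡ-≤ logFactor
          (s≤s (ℕₚ.*-monoʳ-≤ 2 (unique⇒length≤ (Pending.indices-unique initially-pending)))))))
        (output-work entries≡)))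
      (ℕₚ.≤-trans (ℕₚ.≤-reflexive (collect costFactor (suc n) (1 + 2 * n) logFactor))
        -- Initialisation and output contribute `n + 1` each and the loop `1 + 2 * n`; in the sum
        -- `3 + 4 * n`, the 3 is at most 4, hence at most `2 * n`.
        (scale {y = n} 2≤n (ℕₚ.≤-trans (ℕₚ.≤-reflexive (count-work n))
          (ℕₚ.≤-trans (ℕₚ.+-monoˡ-≤ _ (ℕₚ.n≤1+n 3))
            (ℕₚ.≤-trans (ℕₚ.+-monoˡ-≤ (4 * n) (ℕₚ.*-monoʳ-≤ 2 2≤n))
                        (ℕₚ.≤-reflexive (sym (ℕₚ.*-distribʳ-+ n 2 4)))))))) ,
    ℕₚ.≤-trans (ℕₚ.+-mono-≤ initialise-span (ℕₚ.+-mono-≤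
        (ℕₚ.≤-trans loop-span (ℕₚ.*-monoʳ-≤ costFactor (ℕₚ.*-monoˡ-≤ logFactor
          (s≤s (proj₂ isRank ∣ F ∣ (F , feasible , refl))))))
        (output-span entries≡)))
      (ℕₚ.≤-trans (ℕₚ.≤-reflexive (collect-span costFactor rank logFactor))
        -- The three units are initialisation, output and the final round, each at most `rank`.
        (scale {y = rank} 2≤n (ℕₚ.+-mono-≤ 1≤rank (ℕₚ.+-mono-≤ 1≤rank (ℕₚ.+-mono-≤ 1≤rank
          (ℕₚ.m≤m+n rank (rank + (rank + 0))))))))
    where
    1≤rank : 1 ≤ rank
    1≤rank = rank-positive (ℕₚ.≤-trans (ℕₚ.n≤1+n 1) 2≤n) isRank
    collect : ∀ k x y l → k * (x * l) + (k * (y * l) + k * (x * l)) ≡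
              k * ((x + (y + x)) * l)
    collect = solve-∀
    count-work : ∀ n → suc n + (1 + 2 * n + suc n) ≡ 3 + 4 * n
    count-work = solve-∀
    collect-span : ∀ k f l → k * l + (k * ((1 + f) * l) + k * l) ≡
                   k * ((3 + f) * l)
    collect-span = solve-∀

theorem4p2 : (T : LinearOrder) (W : OrderedWeights)
    (timeTrees : TimeTrees T) (dpTrees : DPTrees T W) →
    Σ[ c ∈ ℕ ] (
    (n : ℕ) → 2 ≤ n →
    (S : Vector (Activity T W) n) → SortedByEnd S →
    (rank : ℕ) → IsRank S rank →
    Σ[ r ∈ Run (List (Maybe (OrderedWeights.Carrier W))) ]
    Type1.Executes timeTrees dpTrees S r ×
    Solves S (value r) ×
    work r ≤ c * (n * ⌈log₂ n ⌉) ×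
    span r ≤ c * (rank * ⌈log₂ n ⌉))
theorem4p2 T W timeTrees dpTrees =
  -- This is `12 * costFactor` written out, because the constant is chosen before `n` and `S`, on
  -- which `Analysis` depends.
  12 * (5 * (AugmentedTrees.c timeTrees + AugmentedTrees.c dpTrees) + 9) ,
  λ n 2≤n S sorted → Analysis.execution-bounds timeTrees dpTrees S sorted 2≤n
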